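{- For every integer $n\ge 0$, among all the unpaired parts in the partitions of $5n+4$, the number of parts congruent to $1$ modulo $4$ minus the number congruent to $3$ modulo $4$ is divisible by $5$; that is, $$\sum_{\lambda\vdash 5n+4}\bigl(c_1(\lambda)-c_3(\lambda)\bigr)\equiv 0\pmod 5 .$$
   Context: For an integer partition $\lambda$, pair equal parts as far as possible; the unpaired parts of $\lambda$ are the part sizes occurring with odd multiplicity, each taken once. For $i\in\{1,3\}$, $c_i(\lambda)$ is the number of unpaired parts of $\lambda$ congruent to $i$ modulo $4$. The notation $\lambda\vdash N$ means that $\lambda$ is a partition of $N$. -}

module Defs where

open import Data.Integer.Base as ℤ using (ℤ; 0ℤ)
open import Data.List.Base
  using (List; []; _∷_; _++_; map; foldr; filter; length; replicate; deduplicate; concatMap; upTo)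
open import Data.List.Membership.Propositional using (_∈_; find; lose)
open import Data.List.Membership.Propositional.Properties
  using (∈-map⁺; ∈-map⁻; ∈-concatMap⁺; ∈-concatMap⁻; ∈-upTo⁺; ∈-upTo⁻)
open import Data.List.Properties using (++-cancelˡ; ∷-injectiveʳ)
open import Data.List.Relation.Unary.All as All using (All; []; _∷_)
import Data.List.Relation.Unary.All.Properties as All
open import Data.List.Relation.Unary.AllPairs as AllPairs using (AllPairs; []; _∷_)
import Data.List.Relation.Unary.AllPairs.Properties as AllPairs
open import Data.List.Relation.Unary.Any using (here)
open import Data.List.Relation.Binary.Disjoint.Propositional using (Disjoint)
open import Data.List.Relation.Unary.Linked using (Linked)
open import Data.List.Relation.Unary.Linked.Properties using (AllPairs⇒Linked; Linked⇒AllPairs)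
open import Data.List.Relation.Unary.Unique.Propositional using (Unique)
import Data.List.Relation.Unary.Unique.Propositional.Properties as Unique
open import Data.Nat.Base
open import Data.Nat.DivMod using (_/_; _%_; m/n*n≤m; m*n/n≡m; /-monoˡ-≤)
open import Data.Nat.ListAction using (sum)
open import Data.Nat.ListAction.Properties using (sum-++)
open import Data.Nat.Properties
open import Data.Product.Base using (∃₂; _×_; _,_; proj₁; proj₂)
open import Function.Bundles using (_⇔_; mk⇔)
open import Relation.Binary.PropositionalEquality
  using (_≡_; _≢_; refl; sym; trans; cong; subst; module ≡-Reasoning)
open import Relation.Nullary using (yes; no; contradiction)

infix 4 _⊢_

-- parts ⊢ N: the list is a partition of N, written in weakly decreasing order.
record _⊢_ (parts : List ℕ) (N : ℕ) : Set where
  constructor mk⊢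
  field
    decreasing : Linked _≥_ parts
    positive   : All (0 <_) parts
    total      : sum parts ≡ N

multiplicity : ℕ → List ℕ → ℕ
multiplicity k parts = length (filter (k ≟_) parts)

unpaired : List ℕ → List ℕ
unpaired parts = filter (λ k → multiplicity k parts % 2 ≟ 1) (deduplicate _≟_ parts)

c : ℕ → List ℕ → ℕ
c i parts = length (filter (λ k → k % 4 ≟ i) (unpaired parts))

-- Partitions of N with all parts at most m, split by the multiplicity j of the part m.
partitions≤ : ℕ → ℕ → List (List ℕ)
partitions≤ zero    zero    = [] ∷ []
partitions≤ zero    (suc _) = []
partitions≤ (suc m) N       =
  concatMap (λ j → map (replicate j (suc m) ++_) (partitions≤ m (N ∸ j * suc m)))
            (upTo (suc (N / suc m)))

-- ∈-partitions and partitions-unique below: every partition of N occurs exactly once.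
partitions : ℕ → List (List ℕ)
partitions N = partitions≤ N N

∑[_⊢] : ℕ → (List ℕ → ℤ) → ℤ
∑[ N ⊢] f = foldr ℤ._+_ 0ℤ (map f (partitions N))

private
  sum-replicate : ∀ j k → sum (replicate j k) ≡ j * k
  sum-replicate zero    k = refl
  sum-replicate (suc j) k = cong (k +_) (sum-replicate j k)

  sum-block : ∀ j k xs → sum (replicate j k ++ xs) ≡ j * k + sum xs
  sum-block j k xs = trans (sum-++ (replicate j k) xs) (cong (_+ sum xs) (sum-replicate j k))

  block-decreasing : ∀ {m xs} j → All (_≤ m) xs → AllPairs _≥_ xs →
                     AllPairs _≥_ (replicate j (suc m) ++ xs)
  block-decreasing zero    _  d = d
  block-decreasing (suc j) xs≤m d =
    All.++⁺ (All.replicate⁺ j ≤-refl) (All.map m≤n⇒m≤1+n xs≤m) ∷ block-decreasing j xs≤m d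

  split-block : ∀ {m} xs → AllPairs _≥_ xs → All (_≤ suc m) xs →
                ∃₂ λ j ys → xs ≡ replicate j (suc m) ++ ys × AllPairs _≥_ ys × All (_≤ m) ys
  split-block []       _ _ = 0 , [] , refl , [] , []
  split-block {m} (x ∷ xs) (x≥xs ∷ d) (x≤ ∷ xs≤) with x ≟ suc m
  ... | yes refl with j , ys , eq , d′ , ys≤m ← split-block xs d xs≤ =
        suc j , ys , cong (suc m ∷_) eq , d′ , ys≤m
  ... | no x≢ = 0 , x ∷ xs , refl , x≥xs ∷ d , x≤m ∷ All.map (λ y≤x → ≤-trans y≤x x≤m) x≥xs
    where x≤m = s≤s⁻¹ (≤∧≢⇒< x≤ x≢)

  block-injective : ∀ {m} i j {xs ys} → All (_≤ m) xs → All (_≤ m) ys →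
                    replicate i (suc m) ++ xs ≡ replicate j (suc m) ++ ys → i ≡ j
  block-injective zero    zero    _ _ _ = refl
  block-injective zero    (suc j) (x≤m ∷ _) _ refl = contradiction x≤m 1+n≰n
  block-injective (suc i) zero    _ (y≤m ∷ _) refl = contradiction y≤m 1+n≰n
  block-injective (suc i) (suc j) xs≤m ys≤m eq =
    cong suc (block-injective i j xs≤m ys≤m (∷-injectiveʳ eq))

  j≤N/k : ∀ {j m N} → j * suc m ≤ N → j ≤ N / suc m
  j≤N/k {j} {m} le = subst (_≤ _) (m*n/n≡m j (suc m)) (/-monoˡ-≤ (suc m) le)

  j*k≤N : ∀ {j m N} → j ≤ N / suc m → j * suc m ≤ N
  j*k≤N {j} {m} {N} le = ≤-trans (*-monoˡ-≤ (suc m) le) (m/n*n≤m N (suc m))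

  ∈-partitions≤⁻ : ∀ m N {xs} → xs ∈ partitions≤ m N → xs ⊢ N × All (_≤ m) xs
  ∈-partitions≤⁻ zero    zero (here refl) = mk⊢ Linked.[] [] refl , []
  ∈-partitions≤⁻ (suc m) N xs∈
    with j , j∈ , xs∈map ← find (∈-concatMap⁻ _ {xs = upTo (suc (N / suc m))} xs∈)
    with ys , ys∈ , refl ← ∈-map⁻ _ xs∈map
    with mk⊢ d pos tot , ys≤m ← ∈-partitions≤⁻ m (N ∸ j * suc m) ys∈ =
      mk⊢ (AllPairs⇒Linked (block-decreasing j ys≤m (Linked⇒AllPairs ≥-trans d)))
          (All.++⁺ (All.replicate⁺ j z<s) pos)
          (begin
            sum (replicate j (suc m) ++ ys)  ≡⟨ sum-block j (suc m) ys ⟩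
            j * suc m + sum ys               ≡⟨ cong (j * suc m +_) tot ⟩
            j * suc m + (N ∸ j * suc m)      ≡⟨ m+[n∸m]≡n (j*k≤N (s≤s⁻¹ (∈-upTo⁻ j∈))) ⟩
            N                                ∎)
    , All.++⁺ (All.replicate⁺ j ≤-refl) (All.map m≤n⇒m≤1+n ys≤m)
    where
    open ≡-Reasoning
    ≥-trans : ∀ {a b c} → a ≥ b → b ≥ c → a ≥ c
    ≥-trans p q = ≤-trans q p

  ∈-partitions≤⁺ : ∀ m {xs} → AllPairs _≥_ xs → All (0 <_) xs → All (_≤ m) xs →
                   xs ∈ partitions≤ m (sum xs)
  ∈-partitions≤⁺ zero    []      _         _         = here refl
  ∈-partitions≤⁺ zero    (_ ∷ _) (0<x ∷ _) (x≤0 ∷ _) = contradiction (≤-trans 0<x x≤0) 1+n≰n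
  ∈-partitions≤⁺ (suc m) {xs} d pos xs≤
    with j , ys , refl , d′ , ys≤m ← split-block xs d xs≤ =
      ∈-concatMap⁺ _ (lose {x = j} (∈-upTo⁺ (s≤s (j≤N/k {m = m} j*k≤sum)))
        (∈-map⁺ (replicate j (suc m) ++_) (subst (λ N → ys ∈ partitions≤ m N) (sym rest)
          (∈-partitions≤⁺ m d′ (All.++⁻ʳ (replicate j (suc m)) pos) ys≤m))))
    where
    j*k≤sum : j * suc m ≤ sum (replicate j (suc m) ++ ys)
    j*k≤sum = ≤-trans (m≤m+n _ _) (≤-reflexive (sym (sum-block j (suc m) ys)))
    rest : sum (replicate j (suc m) ++ ys) ∸ j * suc m ≡ sum ys
    rest = trans (cong (_∸ j * suc m) (sum-block j (suc m) ys)) (m+n∸m≡n (j * suc m) (sum ys))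

  parts≤sum : ∀ xs → All (_≤ sum xs) xs
  parts≤sum []       = []
  parts≤sum (x ∷ xs) =
    m≤m+n x (sum xs) ∷ All.map (λ le → ≤-trans le (m≤n+m (sum xs) x)) (parts≤sum xs)

  partitions≤-unique : ∀ m N → Unique (partitions≤ m N)
  partitions≤-unique zero    zero    = [] ∷ []
  partitions≤-unique zero    (suc _) = []
  partitions≤-unique (suc m) N       =
    Unique.concat⁺
      (All.map⁺ (All.universal
        (λ j → Unique.map⁺ (++-cancelˡ (replicate j (suc m)) _ _) (partitions≤-unique m _)) _))
      (AllPairs.map⁺ (AllPairs.map disjoint (Unique.upTo⁺ (suc (N / suc m)))))
    where
    disjoint : ∀ {i j} → i ≢ j →
               Disjoint (map (replicate i (suc m) ++_) (partitions≤ m (N ∸ i * suc m)))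
                        (map (replicate j (suc m) ++_) (partitions≤ m (N ∸ j * suc m)))
    disjoint {i} {j} i≢j (∈i , ∈j)
      with xs , xs∈ , eq ← ∈-map⁻ _ ∈i | ys , ys∈ , eq′ ← ∈-map⁻ _ ∈j =
        i≢j (block-injective i j (proj₂ (∈-partitions≤⁻ m _ xs∈)) (proj₂ (∈-partitions≤⁻ m _ ys∈))
                             (trans (sym eq) eq′))

∈-partitions : ∀ {N xs} → xs ∈ partitions N ⇔ xs ⊢ N
∈-partitions {N} {xs} = mk⇔ (λ xs∈ → proj₁ (∈-partitions≤⁻ N N xs∈)) complete
  where
  complete : xs ⊢ N → xs ∈ partitions N
  complete (mk⊢ d pos refl) =
    ∈-partitions≤⁺ _ (Linked⇒AllPairs (λ p q → ≤-trans q p) d) pos (parts≤sum xs)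

partitions-unique : ∀ N → Unique (partitions N)
partitions-unique N = partitions≤-unique N N

{-# OPTIONS --safe #-}

-- Write E_m = ∏ (1 - q^(mn)), and let χ be the nontrivial character modulo 4. A part k occurs an
-- odd number of times with generating function q^k/(1+q^k) relative to the generating function
-- P = 1/E_1 of partitions, so the sums in question have generating function P S, where
-- S = Σ χ(k) q^k/(1+q^k). Differentiating the triple product at z = ±1 gives, with sums over k ∈ ℤ,
--   2 E_m³ = Σ (-1)^k (2k+1) q^(m k(k+1)/2)   and   ψ (1 - 4S) = Σ (4k+1) q^(2k²+k),
-- where E_1 ψ = E_2². Modulo 5 we have E_m⁵ = E_{5m}, so
--   8P = (2 E_1³)³ / E_5²   and   2P (1 - 4S) = Σ (4k+1) q^(2k²+k) · 2 E_2³ / E_10.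
-- In these theta series the exponents with coefficient prime to 5 are congruent to 0 or 1 modulo 5
-- (0 or 2 for E_2³), so no exponent 5n+4 survives in either product, nor therefore in P S.
-- Everything takes place in (ℤ/5)[[q]]/(q^K), where q is nilpotent and infinite products are finite.

module Submission where

open import Defs
open import Algebra.Bundles using (CommutativeRing)
import Algebra.Solver.Ring as Solver
open import Algebra.Solver.Ring.AlmostCommutativeRing
  using (_-Raw-AlmostCommutative⟶_; fromCommutativeRing)
open import Algebra.Structures using (IsCommutativeRing)
open import Data.Bool.Base using (true; false; if_then_else_)
open import Data.Integer using (ℤ; +_)
open import Data.Integer.Base as ℤ using (-[1+_])
open import Data.Integer.Divisibility using (_∣_)
import Data.Integer.Divisibility.Signed as Signed
import Data.Integer.Properties as ℤ
open import Data.Integer.Tactic.RingSolver using (solve-∀)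
open import Data.List.Base
  using (List; []; _∷_; _++_; map; foldr; filter; length; replicate; deduplicate; concatMap; applyUpTo; upTo)
open import Data.List.Properties using (filter-all; filter-none; filter-accept; filter-reject)
open import Data.List.Relation.Unary.All as All using (All; []; _∷_)
import Data.List.Relation.Unary.All.Properties as All
open import Data.Maybe.Base using (Maybe; just; nothing)
open import Data.Nat using (ℕ)
import Data.Nat as ℕ
open import Data.Nat.Base using (zero; suc; _<_; _≤_; z≤n; s≤s)
open import Data.Nat.DivMod as ℕ using (_/_; _%_)
open import Data.Nat.Properties as ℕ using (_≟_)
import Data.Nat.Tactic.RingSolver as ℕ-Solver
open import Data.Product.Base using (_,_; ∃)
open import Data.Sum.Base as Sum using (_⊎_; inj₁; inj₂)
open import Function.Base using (_∘_; id)
open import Level using (0ℓ)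
open import Relation.Binary.PropositionalEquality as ≡ using (_≡_; _≢_; subst)
open import Relation.Nullary using (Dec; yes; no; does; ¬?; contradiction)
open import Relation.Nullary.Decidable using (_⊎-dec_; toWitness; True)

-- The theta identities call for a derivative and for infinite products; neither is taken literally.
-- The triple product is used in its finite form: a product of a factors in z and b factors in 1/z
-- expands with q-binomial coefficients. Differentiation becomes a second weight 1 + d k on the k-th
-- Laurent coefficient, and adding one factor at a time turns the Leibniz rule into a recurrence.
-- For a = b = 2K the limit is an equality, since a term whose q-binomial coefficient has not yet
-- stabilised carries a power of q that is already zero. This takes place in an arbitrary
-- commutative ring with an image of the integers and a nilpotent q, so that the ring solver never
-- meets a convolution; truncated series are substituted at the end. For the same reason the
-- residues of exponents enter through an abstract filtration. It records only an upper bound for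
-- the residues: 1 + 1 + 1 for the first product and 1 + 2 for the second both stay below 4.

module IntegersModulo (m : ℤ) where
  open Signed using (∣m∣n⇒∣m+n; ∣m⇒∣-m; ∣n⇒∣m*n; ∣m⇒∣m*n)

  infix 4 _≋_
  -- A record, because `a` and `b` could not be inferred from a divisibility statement about their
  -- difference.
  record _≋_ (a b : ℤ) : Set where
    constructor mk≋
    field divides-difference : m Signed.∣ a ℤ.- b

  ≋-reflexive : ∀ {a b} → a ≡ b → a ≋ b
  ≋-reflexive {a} ≡.refl = mk≋ (subst (m Signed.∣_) (≡.sym (ℤ.+-inverseʳ a)) (Signed.divides (+ 0) ≡.refl))

  ≋-sym : ∀ {a b} → a ≋ b → b ≋ a
  ≋-sym {a} {b} (mk≋ p) = mk≋ (subst (m Signed.∣_) (lemma a b) (∣m⇒∣-m p))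
    where
    lemma : ∀ a b → ℤ.- (a ℤ.- b) ≡ b ℤ.- a
    lemma = solve-∀

  ≋-trans : ∀ {a b c} → a ≋ b → b ≋ c → a ≋ c
  ≋-trans {a} {b} {c} (mk≋ p) (mk≋ q) = mk≋ (subst (m Signed.∣_) (lemma a b c) (∣m∣n⇒∣m+n p q))
    where
    lemma : ∀ a b c → (a ℤ.- b) ℤ.+ (b ℤ.- c) ≡ a ℤ.- c
    lemma = solve-∀

  +-cong : ∀ {a b c d} → a ≋ b → c ≋ d → a ℤ.+ c ≋ b ℤ.+ d
  +-cong {a} {b} {c} {d} (mk≋ p) (mk≋ q) = mk≋ (subst (m Signed.∣_) (lemma a b c d) (∣m∣n⇒∣m+n p q))
    where
    lemma : ∀ a b c d → (a ℤ.- b) ℤ.+ (c ℤ.- d) ≡ (a ℤ.+ c) ℤ.- (b ℤ.+ d)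
    lemma = solve-∀

  *-cong : ∀ {a b c d} → a ≋ b → c ≋ d → a ℤ.* c ≋ b ℤ.* d
  *-cong {a} {b} {c} {d} (mk≋ p) (mk≋ q) =
    mk≋ (subst (m Signed.∣_) (lemma a b c d) (∣m∣n⇒∣m+n (∣m⇒∣m*n c p) (∣n⇒∣m*n b q)))
    where
    lemma : ∀ a b c d → (a ℤ.- b) ℤ.* c ℤ.+ b ℤ.* (c ℤ.- d) ≡ a ℤ.* c ℤ.- b ℤ.* d
    lemma = solve-∀

  -‿cong : ∀ {a b} → a ≋ b → ℤ.- a ≋ ℤ.- b
  -‿cong {a} {b} (mk≋ p) = mk≋ (subst (m Signed.∣_) (lemma a b) (∣m⇒∣-m p))
    where
    lemma : ∀ a b → ℤ.- (a ℤ.- b) ≡ ℤ.- a ℤ.- ℤ.- b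
    lemma = solve-∀

  opaque
    ≋-isCommutativeRing : IsCommutativeRing _≋_ ℤ._+_ ℤ._*_ ℤ.-_ (+ 0) (+ 1)
    ≋-isCommutativeRing = record
        { isRing = record
          { +-isAbelianGroup = record
            { isGroup = record
              { isMonoid = record
                { isSemigroup = record
                  { isMagma = record
                    { isEquivalence = record
                      { refl = ≋-reflexive ≡.refl ; sym = ≋-sym ; trans = ≋-trans }
                    ; ∙-cong = +-cong }
                  ; assoc = λ a b c → ≋-reflexive (ℤ.+-assoc a b c) }
                ; identity = (λ a → ≋-reflexive (ℤ.+-identityˡ a)) , (λ a → ≋-reflexive (ℤ.+-identityʳ a)) }
              ; inverse = (λ a → ≋-reflexive (ℤ.+-inverseˡ a)) , (λ a → ≋-reflexive (ℤ.+-inverseʳ a))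
              ; ⁻¹-cong = -‿cong }
            ; comm = λ a b → ≋-reflexive (ℤ.+-comm a b) }
          ; *-cong = *-cong
          ; *-assoc = λ a b c → ≋-reflexive (ℤ.*-assoc a b c)
          ; *-identity = (λ a → ≋-reflexive (ℤ.*-identityˡ a)) , (λ a → ≋-reflexive (ℤ.*-identityʳ a))
          ; distrib = (λ a b c → ≋-reflexive (ℤ.*-distribˡ-+ a b c))
                    , (λ a b c → ≋-reflexive (ℤ.*-distribʳ-+ a b c)) }
        ; *-comm = λ a b → ≋-reflexive (ℤ.*-comm a b) }

  ring : CommutativeRing 0ℓ 0ℓ
  ring = record
    { Carrier = ℤ ; _≈_ = _≋_ ; _+_ = ℤ._+_ ; _*_ = ℤ._*_ ; -_ = ℤ.-_ ; 0# = + 0 ; 1# = + 1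
    ; isCommutativeRing = ≋-isCommutativeRing }

-- Power series truncated at q^K.

module PowerSeries (A : CommutativeRing 0ℓ 0ℓ) (K : ℕ) where
  private
    module A = CommutativeRing A
    open A using (_≈_; _+_; _*_; -_; 0#; 1#)
    open import Relation.Binary.Reasoning.Setoid A.setoid
    open import Algebra.Properties.CommutativeSemigroup A.+-commutativeSemigroup
      using (interchange; x∙yz≈y∙xz)

  Series : Set
  Series = ℕ → A.Carrier

  tail : Series → Series
  tail f i = f (suc i)

  const : A.Carrier → Series
  const a zero    = a
  const a (suc _) = 0#

  infixl 6 _⊕_
  infixl 7 _⊛_

  _⊕_ : Series → Series → Series
  (f ⊕ g) i = f i + g i

  -- The Cauchy product, read off from f = f 0 + q · tail f, so that induction on the exponent
  -- replaces manipulation of finite sums.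
  _⊛_ : Series → Series → Series
  (f ⊛ g) zero    = f 0 * g 0
  (f ⊛ g) (suc n) = f 0 * g (suc n) + (tail f ⊛ g) n

  ⊛-cong : ∀ {f f′ g g′} n → (∀ i → i ≤ n → f i ≈ f′ i) → (∀ i → i ≤ n → g i ≈ g′ i) →
           (f ⊛ g) n ≈ (f′ ⊛ g′) n
  ⊛-cong zero    p q = A.*-cong (p 0 z≤n) (q 0 z≤n)
  ⊛-cong (suc n) p q = A.+-cong (A.*-cong (p 0 z≤n) (q (suc n) ℕ.≤-refl))
    (⊛-cong n (λ i i≤n → p (suc i) (s≤s i≤n)) (λ i i≤n → q i (ℕ.m≤n⇒m≤1+n i≤n)))

  ⊛-zeroˡ : ∀ f {g} → (∀ i → f i ≈ 0#) → ∀ n → (f ⊛ g) n ≈ 0#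
  ⊛-zeroˡ f     p zero    = A.trans (A.*-congʳ (p 0)) (A.zeroˡ _)
  ⊛-zeroˡ f {g} p (suc n) = begin
    f 0 * g (suc n) + (tail f ⊛ g) n
      ≈⟨ A.+-cong (A.trans (A.*-congʳ (p 0)) (A.zeroˡ _)) (⊛-zeroˡ (tail f) (λ i → p (suc i)) n) ⟩
    0# + 0#
      ≈⟨ A.+-identityˡ 0# ⟩
    0# ∎

  const-⊛ : ∀ a g n → (const a ⊛ g) n ≈ a * g n
  const-⊛ a g zero    = A.refl
  const-⊛ a g (suc n) =
    A.trans (A.+-congˡ (⊛-zeroˡ _ (λ _ → A.refl) n)) (A.+-identityʳ _)

  ⊛-distribʳ : ∀ h f g n → ((f ⊕ g) ⊛ h) n ≈ (f ⊛ h ⊕ g ⊛ h) n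
  ⊛-distribʳ h f g zero    = A.distribʳ _ _ _
  ⊛-distribʳ h f g (suc n) = A.trans
    (A.+-cong (A.distribʳ _ _ _) (⊛-distribʳ h (tail f) (tail g) n)) (interchange _ _ _ _)

  ⊛-scaleˡ : ∀ a f g n → ((λ i → a * f i) ⊛ g) n ≈ a * (f ⊛ g) n
  ⊛-scaleˡ a f g zero    = A.*-assoc _ _ _
  ⊛-scaleˡ a f g (suc n) = A.trans
    (A.+-cong (A.*-assoc _ _ _) (⊛-scaleˡ a (tail f) g n)) (A.sym (A.distribˡ _ _ _))

  -- Mirror image of the defining recursion, splitting off the constant term of the right factor;
  -- commutativity is the agreement of the two recursions.
  ⊛-sucʳ : ∀ f g n → (f ⊛ g) (suc n) ≈ f (suc n) * g 0 + (f ⊛ tail g) n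
  ⊛-sucʳ f g zero    = A.+-comm _ _
  ⊛-sucʳ f g (suc n) = begin
    f 0 * g (suc (suc n)) + (tail f ⊛ g) (suc n)
      ≈⟨ A.+-congˡ (⊛-sucʳ (tail f) g n) ⟩
    f 0 * g (suc (suc n)) + (f (suc (suc n)) * g 0 + (tail f ⊛ tail g) n)
      ≈⟨ x∙yz≈y∙xz _ _ _ ⟩
    f (suc (suc n)) * g 0 + (f ⊛ tail g) (suc n) ∎

  ⊛-comm : ∀ f g n → (f ⊛ g) n ≈ (g ⊛ f) n
  ⊛-comm f g zero    = A.*-comm _ _
  ⊛-comm f g (suc n) = A.trans
    (A.+-cong (A.*-comm _ _) (⊛-comm (tail f) g n)) (A.sym (⊛-sucʳ g f n))

  ⊛-assoc : ∀ f g h n → ((f ⊛ g) ⊛ h) n ≈ (f ⊛ (g ⊛ h)) n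
  ⊛-assoc f g h zero    = A.*-assoc _ _ _
  ⊛-assoc f g h (suc n) = begin
    f 0 * g 0 * h (suc n) + (((λ i → f 0 * tail g i) ⊕ tail f ⊛ g) ⊛ h) n
      ≈⟨ A.+-cong (A.*-assoc _ _ _) (⊛-distribʳ h (λ i → f 0 * tail g i) (tail f ⊛ g) n) ⟩
    f 0 * (g 0 * h (suc n)) + (((λ i → f 0 * tail g i) ⊛ h) n + ((tail f ⊛ g) ⊛ h) n)
      ≈⟨ A.+-congˡ (A.+-cong (⊛-scaleˡ (f 0) (tail g) h n) (⊛-assoc (tail f) g h n)) ⟩
    f 0 * (g 0 * h (suc n)) + (f 0 * (tail g ⊛ h) n + (tail f ⊛ (g ⊛ h)) n)
      ≈⟨ A.+-assoc _ _ _ ⟨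
    f 0 * (g 0 * h (suc n)) + f 0 * (tail g ⊛ h) n + (tail f ⊛ (g ⊛ h)) n
      ≈⟨ A.+-congʳ (A.distribˡ _ _ _) ⟨
    f 0 * (g ⊛ h) (suc n) + (tail f ⊛ (g ⊛ h)) n ∎

  ⊛-identityˡ : ∀ f n → (const 1# ⊛ f) n ≈ f n
  ⊛-identityˡ f n = A.trans (const-⊛ 1# f n) (A.*-identityˡ _)

  ⊛-distribˡ : ∀ h f g n → (h ⊛ (f ⊕ g)) n ≈ (h ⊛ f ⊕ h ⊛ g) n
  ⊛-distribˡ h f g n = A.trans (⊛-comm h (f ⊕ g) n)
    (A.trans (⊛-distribʳ h f g n) (A.+-cong (⊛-comm f h n) (⊛-comm g h n)))

  const-+ : ∀ a b n → const (a + b) n ≈ (const a ⊕ const b) n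
  const-+ a b zero    = A.refl
  const-+ a b (suc n) = A.sym (A.+-identityˡ 0#)

  const-* : ∀ a b n → const (a * b) n ≈ (const a ⊛ const b) n
  const-* a b zero    = A.refl
  const-* a b (suc n) = A.sym (A.trans (const-⊛ a (const b) (suc n)) (A.zeroʳ a))

  const-neg : ∀ a n → const (- a) n ≈ - const a n
  const-neg a zero    = A.refl
  const-neg a (suc n) = A.sym (A.trans (A.sym (A.+-identityʳ (- 0#))) (A.-‿inverseˡ 0#))

  -- Equality in A[[q]] / (q^K).
  infix 4 _≈ᵏ_
  record _≈ᵏ_ (f g : Series) : Set where
    constructor mk≈
    field coeff : ∀ i → i < K → f i ≈ g i

  pointwise : ∀ {f g} → (∀ i → f i ≈ g i) → f ≈ᵏ g
  pointwise p = mk≈ (λ i _ → p i)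

  opaque
    ≈ᵏ-isCommutativeRing : IsCommutativeRing _≈ᵏ_ _⊕_ _⊛_ (λ f i → - f i) (const 0#) (const 1#)
    ≈ᵏ-isCommutativeRing = record
        { isRing = record
          { +-isAbelianGroup = record
            { isGroup = record
              { isMonoid = record
                { isSemigroup = record
                  { isMagma = record
                    { isEquivalence = record
                      { refl  = pointwise (λ _ → A.refl)
                      ; sym   = λ (mk≈ p) → mk≈ (λ i i<K → A.sym (p i i<K))
                      ; trans = λ (mk≈ p) (mk≈ q) → mk≈ (λ i i<K → A.trans (p i i<K) (q i i<K)) }
                    ; ∙-cong = λ (mk≈ p) (mk≈ q) → mk≈ (λ i i<K → A.+-cong (p i i<K) (q i i<K)) }
                  ; assoc = λ f g h → pointwise (λ i → A.+-assoc (f i) (g i) (h i)) }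
                ; identity = (λ f → pointwise (λ i → A.trans (A.+-congʳ (const-0 i)) (A.+-identityˡ _)))
                           , (λ f → pointwise (λ i → A.trans (A.+-congˡ (const-0 i)) (A.+-identityʳ _))) }
              ; inverse = (λ f → pointwise (λ i → A.trans (A.-‿inverseˡ _) (A.sym (const-0 i))))
                        , (λ f → pointwise (λ i → A.trans (A.-‿inverseʳ _) (A.sym (const-0 i))))
              ; ⁻¹-cong = λ (mk≈ p) → mk≈ (λ i i<K → A.-‿cong (p i i<K)) }
            ; comm = λ f g → pointwise (λ i → A.+-comm (f i) (g i)) }
          ; *-cong = λ (mk≈ p) (mk≈ q) → mk≈ (λ n n<K → ⊛-cong n (λ i i≤n → p i (ℕ.≤-<-trans i≤n n<K))
                                                                (λ i i≤n → q i (ℕ.≤-<-trans i≤n n<K)))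
          ; *-assoc = λ f g h → pointwise (⊛-assoc f g h)
          ; *-identity = (λ f → pointwise (⊛-identityˡ f))
                       , (λ f → pointwise (λ n → A.trans (⊛-comm f (const 1#) n) (⊛-identityˡ f n)))
          ; distrib = (λ h f g → pointwise (⊛-distribˡ h f g))
                    , (λ h f g → pointwise (⊛-distribʳ h f g)) }
        ; *-comm = λ f g → pointwise (⊛-comm f g) }
      where
      const-0 : ∀ i → const 0# i ≈ 0#
      const-0 zero    = A.refl
      const-0 (suc _) = A.refl

  truncated : CommutativeRing 0ℓ 0ℓ
  truncated = record
    { Carrier = Series ; _≈_ = _≈ᵏ_
    ; _+_ = _⊕_ ; _*_ = _⊛_ ; -_ = λ f i → - f i ; 0# = const 0# ; 1# = const 1#
    ; isCommutativeRing = ≈ᵏ-isCommutativeRing }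

-- Finite products and nilpotent expansions over a ring with integer scalars.

record IntegerScalars (R : CommutativeRing 0ℓ 0ℓ) : Set where
  open CommutativeRing R
  field
    ⟦_⟧    : ℤ → Carrier
    +-homo : ∀ a b → ⟦ a ℤ.+ b ⟧ ≈ ⟦ a ⟧ + ⟦ b ⟧
    *-homo : ∀ a b → ⟦ a ℤ.* b ⟧ ≈ ⟦ a ⟧ * ⟦ b ⟧
    -‿homo : ∀ a → ⟦ ℤ.- a ⟧ ≈ - ⟦ a ⟧
    0-homo : ⟦ + 0 ⟧ ≈ 0#
    1-homo : ⟦ + 1 ⟧ ≈ 1#

-- Renormalises ⟦_⟧ to send 0 and 1 to 0# and 1# on the nose, so that the ring solver can read
-- 0# and 1# as constants.
module NormalisedScalars {R : CommutativeRing 0ℓ 0ℓ} (scalars : IntegerScalars R) where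
  open CommutativeRing R
  open IntegerScalars scalars

  ι : ℤ → Carrier
  ι (+ 0)           = 0#
  ι (+ 1)           = 1#
  ι c@(+ suc (suc _)) = ⟦ c ⟧
  ι c@(-[1+ _ ])    = ⟦ c ⟧

  ι≈ : ∀ c → ι c ≈ ⟦ c ⟧
  ι≈ (+ 0)             = sym 0-homo
  ι≈ (+ 1)             = sym 1-homo
  ι≈ (+ suc (suc _))   = refl
  ι≈ (-[1+ _ ])        = refl

  normalised : ℤ.+-*-rawRing -Raw-AlmostCommutative⟶ fromCommutativeRing R
  normalised = record
    { ⟦_⟧    = ι
    ; +-homo = λ a b → trans (ι≈ _) (trans (+-homo a b) (sym (+-cong (ι≈ a) (ι≈ b))))
    ; *-homo = λ a b → trans (ι≈ _) (trans (*-homo a b) (sym (*-cong (ι≈ a) (ι≈ b))))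
    ; -‿homo = λ a → trans (ι≈ _) (trans (-‿homo a) (sym (-‿cong (ι≈ a))))
    ; 0-homo = refl
    ; 1-homo = refl
    }

-- Taken as coefficients these give x + x³ + x⁵ + ... = x / (1 - x²), the series of odd
-- multiplicities.
isOdd : ℕ → ℤ
isOdd 0             = + 0
isOdd 1             = + 1
isOdd (suc (suc n)) = isOdd n

module Products {R : CommutativeRing 0ℓ 0ℓ} (scalars : IntegerScalars R) where
  open CommutativeRing R
  open NormalisedScalars scalars public using (ι; ι≈; normalised)
  open _-Raw-AlmostCommutative⟶_ normalised public
    using () renaming (+-homo to ι-+; *-homo to ι-*; -‿homo to ι-neg)
  open import Algebra.Properties.Semiring.Exp semiring public using (_^_; ^-homo-*; ^-assocʳ; ^-congˡ)
  open import Relation.Binary.Reasoning.Setoid setoid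

  decideCoefficient : ∀ a b → Maybe (ι a ≈ ι b)
  decideCoefficient a b with a ℤ.≟ b
  ... | yes ≡.refl = just refl
  ... | no  _      = nothing

  open Solver ℤ.+-*-rawRing (fromCommutativeRing R) normalised decideCoefficient public
    using (solve; _:=_; _:+_; _:*_; _:-_; :-_; con; _:^_)

  prod : ℕ → (ℕ → Carrier) → Carrier
  prod zero    f = 1#
  prod (suc n) f = prod n f * f n

  prod-cong : ∀ n {f g} → (∀ i → f i ≈ g i) → prod n f ≈ prod n g
  prod-cong zero    p = refl
  prod-cong (suc n) p = *-cong (prod-cong n p) (p n)

  prod-* : ∀ n f g → prod n f * prod n g ≈ prod n (λ i → f i * g i)
  prod-* zero    f g = *-identityˡ 1#
  prod-* (suc n) f g = begin
    prod n f * f n * (prod n g * g n)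
      ≈⟨ solve 4 (λ a b c d → a :* b :* (c :* d) := a :* c :* (b :* d)) refl _ _ _ _ ⟩
    prod n f * prod n g * (f n * g n)
      ≈⟨ *-congʳ (prod-* n f g) ⟩
    prod n (λ i → f i * g i) * (f n * g n) ∎

  prod-1 : ∀ n {f} → (∀ i → f i ≈ 1#) → prod n f ≈ 1#
  prod-1 zero    p = refl
  prod-1 (suc n) p = trans (*-cong (prod-1 n p) (p n)) (*-identityˡ 1#)

  prod-extend : ∀ {f N} → (∀ i → N ≤ i → f i ≈ 1#) → ∀ {n} → N ≤ n → prod n f ≈ prod N f
  prod-extend {f} {N} p N≤n = go (ℕ.≤⇒≤′ N≤n)
    where
    go : ∀ {n} → N ℕ.≤′ n → prod n f ≈ prod N f
    go (ℕ.≤′-reflexive ≡.refl) = refl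
    go (ℕ.≤′-step N≤′n) = trans (*-cong (go N≤′n) (p _ (ℕ.≤′⇒≤ N≤′n))) (*-identityʳ _)

  prod-double : ∀ n f → prod (n ℕ.* 2) f ≈ prod n (λ i → f (i ℕ.* 2) * f (suc (i ℕ.* 2)))
  prod-double zero    f = refl
  prod-double (suc n) f = trans (*-assoc _ _ _) (*-congʳ (prod-double n f))

  ^-zero-≤ : ∀ {x m n} → x ^ m ≈ 0# → m ≤ n → x ^ n ≈ 0#
  ^-zero-≤ {x} {m} p m≤n with k , ≡.refl ← ℕ.m≤n⇒∃[o]m+o≡n m≤n =
    trans (^-homo-* x m k) (trans (*-congʳ p) (zeroˡ _))

  ^-zero-* : ∀ {x m} k → x ^ m ≈ 0# → (x ^ suc k) ^ m ≈ 0#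
  ^-zero-* {x} {m} k p = trans (^-assocʳ x (suc k) m) (^-zero-≤ p (ℕ.m≤m+n m _))

  -- Horner form splits off j = 0 from Σ v j x^j, which later separates the partitions that lack the
  -- part in question.
  horner : ℕ → (ℕ → ℤ) → Carrier → Carrier
  horner zero    v x = 0#
  horner (suc n) v x = ι (v 0) + x * horner n (λ j → v (suc j)) x

  geo : ℕ → Carrier → Carrier
  geo n = horner n (λ _ → + 1)

  geo-inverse : ∀ {n x} → x ^ n ≈ 0# → geo n x * (1# - x) ≈ 1#
  geo-inverse {n} {x} p = begin
    geo n x * (1# - x)          ≈⟨ +-identityʳ _ ⟨
    geo n x * (1# - x) + 0#     ≈⟨ +-congˡ p ⟨
    geo n x * (1# - x) + x ^ n  ≈⟨ telescope n ⟩
    1#                          ∎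
    where
    telescope : ∀ n → geo n x * (1# - x) + x ^ n ≈ 1#
    telescope zero    = trans (+-congʳ (zeroˡ _)) (+-identityˡ _)
    telescope (suc n) = begin
      (1# + x * geo n x) * (1# - x) + x * x ^ n
        ≈⟨ solve 3 (λ x g y → (con (+ 1) :+ x :* g) :* (con (+ 1) :- x) :+ x :* y
                    := (con (+ 1) :- x) :+ x :* (g :* (con (+ 1) :- x) :+ y)) refl _ _ _ ⟩
      (1# - x) + x * (geo n x * (1# - x) + x ^ n)
        ≈⟨ +-congˡ (*-congˡ (telescope n)) ⟩
      (1# - x) + x * 1#
        ≈⟨ solve 1 (λ x → (con (+ 1) :- x) :+ x :* con (+ 1) := con (+ 1)) refl _ ⟩
      1# ∎

  -- The expansion of x / (1 + x).
  lambert : ℕ → Carrier → Carrier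
  lambert n x = horner n isOdd x * (1# - x)

  lambert-* : ∀ {n x} → x ^ n ≈ 0# → lambert n x * (1# + x) ≈ x
  lambert-* {n} {x} p = let r , eq = telescope n in begin
    horner n isOdd x * (1# - x) * (1# + x)            ≈⟨ +-identityʳ _ ⟨
    horner n isOdd x * (1# - x) * (1# + x) + 0#       ≈⟨ +-congˡ (trans (*-congʳ p) (zeroˡ r)) ⟨
    horner n isOdd x * (1# - x) * (1# + x) + x ^ n * r  ≈⟨ eq ⟩
    x                                                 ∎
    where
    -- The cofactor `r` of the truncation error is `x` for even `n` and 1 for odd `n`; only its
    -- existence matters. Induction in steps of two matches the period of `isOdd`.
    telescope : ∀ n → ∃ λ r → horner n isOdd x * (1# - x) * (1# + x) + x ^ n * r ≈ x
    telescope 0 = x , solve 1 (λ x →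
      con (+ 0) :* (con (+ 1) :- x) :* (con (+ 1) :+ x) :+ con (+ 1) :* x := x) refl x
    telescope 1 = 1# , solve 1 (λ x →
      (con (+ 0) :+ x :* con (+ 0)) :* (con (+ 1) :- x) :* (con (+ 1) :+ x)
        :+ (x :* con (+ 1)) :* con (+ 1) := x) refl x
    telescope (suc (suc n)) with r , eq ← telescope n = r , (begin
      (0# + x * (1# + x * h)) * (1# - x) * (1# + x) + x * (x * x ^ n) * r
        ≈⟨ solve 4 (λ x h y r →
             (con (+ 0) :+ x :* (con (+ 1) :+ x :* h)) :* (con (+ 1) :- x) :* (con (+ 1) :+ x)
               :+ x :* (x :* y) :* r
             := x :- x :* x :* x :+ x :* x :* (h :* (con (+ 1) :- x) :* (con (+ 1) :+ x) :+ y :* r))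
           refl x h (x ^ n) r ⟩
      x - x * x * x + x * x * (h * (1# - x) * (1# + x) + x ^ n * r)
        ≈⟨ +-congˡ (*-congˡ eq) ⟩
      x - x * x * x + x * x * x
        ≈⟨ solve 1 (λ x → x :- x :* x :* x :+ x :* x :* x := x) refl x ⟩
      x ∎)
      where h = horner n isOdd x

private
  -- For the terms with i + j = 2M: a small j pushes i more than K beyond M, where `T i M` is
  -- already zero.
  far-right : ∀ {K i j} → let M = K ℕ.+ K in i ℕ.+ j ≡ M ℕ.+ M → j < K → K ℕ.+ M < i
  far-right {K} {i} {j} eq j<K = ℕ.+-cancelʳ-< j (K ℕ.+ M) i (begin-strict
    K ℕ.+ M ℕ.+ j     <⟨ ℕ.+-monoʳ-< (K ℕ.+ M) j<K ⟩
    K ℕ.+ M ℕ.+ K     ≡⟨ ℕ.+-assoc K M K ⟩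
    K ℕ.+ (M ℕ.+ K)   ≡⟨ ≡.cong (K ℕ.+_) (ℕ.+-comm M K) ⟩
    K ℕ.+ (K ℕ.+ M)   ≡⟨ ℕ.+-assoc K K M ⟨
    M ℕ.+ M           ≡⟨ eq ⟨
    i ℕ.+ j           ∎)
    where
    open ℕ.≤-Reasoning
    M = K ℕ.+ K

-- The finite triple product and its derivative.

module FiniteTripleProduct {R : CommutativeRing 0ℓ 0ℓ} (scalars : IntegerScalars R)
  (K : ℕ) (Q α β : CommutativeRing.Carrier R)
  (Q-nilpotent : CommutativeRing._≈_ R (Products._^_ scalars Q K) (CommutativeRing.0# R)) where
  open CommutativeRing R
  open Products scalars
  open import Relation.Binary.Reasoning.Setoid setoid

  -- Carrying both indices of the antidiagonal avoids truncated subtraction.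
  anti : ℕ → (ℕ → ℕ → Carrier) → Carrier
  anti zero    F = F 0 0
  anti (suc n) F = F 0 (suc n) + anti n (λ i j → F (suc i) j)

  anti-cong : ∀ n {F H} → (∀ i j → i ℕ.+ j ≡ n → F i j ≈ H i j) → anti n F ≈ anti n H
  anti-cong zero    p = p 0 0 ≡.refl
  anti-cong (suc n) p = +-cong (p 0 (suc n) ≡.refl) (anti-cong n (λ i j eq → p (suc i) j (≡.cong suc eq)))

  anti-+ : ∀ n F H → anti n (λ i j → F i j + H i j) ≈ anti n F + anti n H
  anti-+ zero    F H = refl
  anti-+ (suc n) F H = trans (+-congˡ (anti-+ n _ _))
    (solve 4 (λ a b c d → a :+ b :+ (c :+ d) := a :+ c :+ (b :+ d)) refl _ _ _ _)

  anti-* : ∀ n x F → anti n (λ i j → x * F i j) ≈ x * anti n F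
  anti-* zero    x F = refl
  anti-* (suc n) x F = trans (+-congˡ (anti-* n x _)) (sym (distribˡ x _ _))

  -- Pascal's rule summed over a row: an interior entry of row n + 1 receives a summand from each of
  -- its two neighbours in row n, a border entry from only one.
  anti-pascal : ∀ n H X Y → (∀ j → H 0 (suc j) ≈ X 0 j) → (∀ i → H (suc i) 0 ≈ Y i 0) →
                (∀ i j → H (suc i) (suc j) ≈ X (suc i) j + Y i (suc j)) →
                anti (suc n) H ≈ anti n X + anti n Y
  anti-pascal n H X Y first last step =
    trans (+-congʳ (first n)) (trans (+-comm _ _) (go n H X Y last step))
    where
    -- The border summand `X 0 n` stays pending; once `i` is shifted, `X 1 n` takes its place.
    go : ∀ n H X Y → (∀ i → H (suc i) 0 ≈ Y i 0) →
         (∀ i j → H (suc i) (suc j) ≈ X (suc i) j + Y i (suc j)) →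
         anti n (λ i j → H (suc i) j) + X 0 n ≈ anti n X + anti n Y
    go zero    H X Y last step = trans (+-congʳ (last 0)) (+-comm _ _)
    go (suc n) H X Y last step = begin
      H 1 (suc n) + anti n (λ i j → H (suc (suc i)) j) + X 0 (suc n)
        ≈⟨ +-congʳ (+-congʳ (step 0 n)) ⟩
      X 1 n + Y 0 (suc n) + anti n (λ i j → H (suc (suc i)) j) + X 0 (suc n)
        ≈⟨ solve 4 (λ a b c d → a :+ b :+ c :+ d := b :+ d :+ (c :+ a)) refl _ _ _ _ ⟩
      Y 0 (suc n) + X 0 (suc n) + (anti n (λ i j → H (suc (suc i)) j) + X 1 n)
        ≈⟨ +-congˡ (go n (λ i j → H (suc i) j) (λ i j → X (suc i) j) (λ i j → Y (suc i) j)
                     (λ i → last (suc i)) (λ i j → step (suc i) j)) ⟩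
      Y 0 (suc n) + X 0 (suc n) + (anti n (λ i j → X (suc i) j) + anti n (λ i j → Y (suc i) j))
        ≈⟨ solve 4 (λ a b c d → a :+ b :+ (c :+ d) := b :+ c :+ (a :+ d)) refl _ _ _ _ ⟩
      anti (suc n) X + anti (suc n) Y ∎

  -- The q-Pochhammer symbol (Q; Q)_n. Nilpotency makes each factor a unit, so that quotients of
  -- such symbols make sense.
  Φ : ℕ → Carrier
  Φ n = prod n (λ i → 1# - Q ^ suc i)

  Φ⁻¹ : ℕ → Carrier
  Φ⁻¹ n = prod n (λ i → geo K (Q ^ suc i))

  geo-Q : ∀ i → geo K (Q ^ suc i) * (1# - Q ^ suc i) ≈ 1#
  geo-Q i = geo-inverse {K} (^-zero-* {Q} {K} i Q-nilpotent)

  Φ-inverse : ∀ n → Φ n * Φ⁻¹ n ≈ 1#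
  Φ-inverse n = trans (prod-* n _ _) (prod-1 n (λ i → trans (*-comm _ _) (geo-Q i)))

  -- Later factors are 1 because Q^K = 0, so `Φ K` stands for the infinite product.
  Φ-limit : ∀ {n} → K ≤ n → Φ n ≈ Φ K
  Φ-limit = prod-extend λ i K≤i →
    trans (+-congˡ (-‿cong (^-zero-≤ {Q} {K} Q-nilpotent (ℕ.m≤n⇒m≤1+n K≤i))))
          (solve 0 (con (+ 1) :- con (+ 0) := con (+ 1)) refl)

  -- The q-binomial coefficient [i + j choose i].
  G : ℕ → ℕ → Carrier
  G i j = Φ (i ℕ.+ j) * Φ⁻¹ i * Φ⁻¹ j

  G-sym : ∀ i j → G i j ≈ G j i
  G-sym i j = trans (*-assoc _ _ _) (trans (*-cong (reflexive (≡.cong Φ (ℕ.+-comm i j))) (*-comm _ _))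
    (sym (*-assoc _ _ _)))

  G-0ˡ : ∀ j → G 0 j ≈ 1#
  G-0ˡ j = trans (*-congʳ (*-identityʳ _)) (Φ-inverse j)

  G-0ʳ : ∀ i → G i 0 ≈ 1#
  G-0ʳ i = trans (G-sym i 0) (G-0ˡ i)

  -- Split 1 - x y as (1 - y) + y (1 - x) for x = Q^(i+1), y = Q^(j+1); the two brackets cancel
  -- against `h` and `g`.
  G-pascalʳ : ∀ i j → G (suc i) (suc j) ≈ G (suc i) j + Q ^ suc j * G i (suc j)
  G-pascalʳ i j = begin
    F * (1# - Q ^ suc (i ℕ.+ suc j)) * (a * g) * (b * h)
      ≈⟨ *-congʳ (*-congʳ (*-congˡ (+-congˡ (-‿cong (^-homo-* Q (suc i) (suc j)))))) ⟩
    F * (1# - x * y) * (a * g) * (b * h)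
      ≈⟨ solve 7 (λ F a b g h x y →
           F :* (con (+ 1) :- x :* y) :* (a :* g) :* (b :* h) :=
           F :* a :* b :* (g :* (h :* (con (+ 1) :- y)) :+ y :* h :* (g :* (con (+ 1) :- x))))
           refl F a b g h x y ⟩
    F * a * b * (g * (h * (1# - y)) + y * h * (g * (1# - x)))
      ≈⟨ *-congˡ (+-cong (*-congˡ (geo-Q j)) (*-congˡ (geo-Q i))) ⟩
    F * a * b * (g * 1# + y * h * 1#)
      ≈⟨ solve 6 (λ F a b g h y → F :* a :* b :* (g :* con (+ 1) :+ y :* h :* con (+ 1)) :=
           F :* (a :* g) :* b :+ y :* (F :* a :* (b :* h))) refl F a b g h y ⟩
    F * (a * g) * b + y * G i (suc j)
      ≈⟨ +-congʳ (*-congʳ (*-congʳ (reflexive (≡.cong Φ (ℕ.+-suc i j))))) ⟩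
    G (suc i) j + y * G i (suc j) ∎
    where
    F = Φ (i ℕ.+ suc j) ; a = Φ⁻¹ i ; b = Φ⁻¹ j
    x = Q ^ suc i ; y = Q ^ suc j ; g = geo K x ; h = geo K y

  G-pascalˡ : ∀ i j → G (suc i) (suc j) ≈ Q ^ suc i * G (suc i) j + G i (suc j)
  G-pascalˡ i j = begin
    G (suc i) (suc j)                        ≈⟨ G-sym (suc i) (suc j) ⟩
    G (suc j) (suc i)                        ≈⟨ G-pascalʳ j i ⟩
    G (suc j) i + Q ^ suc i * G j (suc i)    ≈⟨ +-cong (G-sym (suc j) i) (*-congˡ (G-sym j (suc i))) ⟩
    G i (suc j) + Q ^ suc i * G (suc i) j    ≈⟨ +-comm _ _ ⟩
    Q ^ suc i * G (suc i) j + G i (suc j)    ∎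

  -- The sum in the q-binomial theorem, with the sequence `f` in place of Q^(i(i-1)/2) z^i.
  Λ : ℕ → (ℕ → Carrier) → Carrier
  Λ n f = anti n (λ i j → G i j * f i)

  Λ-pascalʳ : ∀ n f → Λ (suc n) f ≈ Λ n f + anti n (λ i j → G i j * (Q ^ j * f (suc i)))
  Λ-pascalʳ n f = anti-pascal n (λ i j → G i j * f i)
    (λ i j → G i j * f i) (λ i j → G i j * (Q ^ j * f (suc i)))
    (λ j → *-congʳ (trans (G-0ˡ (suc j)) (sym (G-0ˡ j))))
    (λ i → *-cong (trans (G-0ʳ (suc i)) (sym (G-0ʳ i))) (sym (*-identityˡ _)))
    (λ i j → trans (*-congʳ (G-pascalʳ i j))
      (solve 4 (λ a b c d → (a :+ b :* c) :* d := a :* d :+ c :* (b :* d)) refl _ _ _ _))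

  Λ-pascalˡ : ∀ n f → Λ (suc n) f ≈ anti n (λ i j → G i j * (Q ^ i * f i)) + Λ n (λ i → f (suc i))
  Λ-pascalˡ n f = anti-pascal n (λ i j → G i j * f i)
    (λ i j → G i j * (Q ^ i * f i)) (λ i j → G i j * f (suc i))
    (λ j → *-cong (trans (G-0ˡ (suc j)) (sym (G-0ˡ j))) (sym (*-identityˡ _)))
    (λ i → *-congʳ (trans (G-0ʳ (suc i)) (sym (G-0ʳ i))))
    (λ i j → trans (*-congʳ (G-pascalˡ i j))
      (solve 4 (λ a b c d → (a :* b :+ c) :* d := b :* (a :* d) :+ c :* d) refl _ _ _ _))

  Λ-scale : ∀ n x {F : ℕ → ℕ → Carrier} {f : ℕ → Carrier} → (∀ i j → i ℕ.+ j ≡ n → F i j ≈ x * f i) →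
            anti n (λ i j → G i j * F i j) ≈ x * Λ n f
  Λ-scale n x p = trans (anti-cong n (λ i j eq → trans (*-congˡ (p i j eq))
      (solve 3 (λ g x t → g :* (x :* t) := x :* (g :* t)) refl _ _ _))) (anti-* n x _)

  Λ-linear : ∀ n x y {h f g : ℕ → Carrier} → (∀ i → h i ≈ x * f i + y * g i) →
             Λ n h ≈ x * Λ n f + y * Λ n g
  Λ-linear n x y p = trans (anti-cong n (λ i j _ → trans (*-congˡ (p i)) (distribˡ _ _ _)))
    (trans (anti-+ n _ _) (+-cong (Λ-scale n x (λ _ _ _ → refl)) (Λ-scale n y (λ _ _ _ → refl))))

  theta : Carrier → ℕ → Carrier
  theta x zero    = 1#
  theta x (suc k) = theta x k * (x * Q ^ k)

  -- T i b is the coefficient τ (i - b) of z^(i-b) in the triple product, up to a q-binomial: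
  -- τ k = α^k Q^(k(k-1)/2) and τ (- k) = β^k Q^(k(k-1)/2) for k ≥ 0.
  T : ℕ → ℕ → Carrier
  T zero    b       = theta β b
  T (suc i) zero    = theta α (suc i)
  T (suc i) (suc b) = T i b

  T-zero : ∀ i → T i 0 ≡ theta α i
  T-zero zero    = ≡.refl
  T-zero (suc i) = ≡.refl

  theta-vanishes : ∀ {x k} → K < k → theta x k ≈ 0#
  theta-vanishes {x} {suc k} (s≤s K≤k) =
    trans (*-congˡ (trans (*-congˡ (^-zero-≤ {Q} {K} Q-nilpotent K≤k)) (zeroʳ x))) (zeroʳ _)

  T-vanishes : ∀ i b → K ℕ.+ i < b ⊎ K ℕ.+ b < i → T i b ≈ 0#
  T-vanishes zero    b       (inj₁ lt) = theta-vanishes (subst (_< b) (ℕ.+-identityʳ K) lt)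
  T-vanishes (suc i) zero    (inj₂ lt) = theta-vanishes (subst (_< suc i) (ℕ.+-identityʳ K) lt)
  T-vanishes (suc i) (suc b) (inj₁ lt) =
    T-vanishes i b (inj₁ (ℕ.≤-pred (subst (_< suc b) (ℕ.+-suc K i) lt)))
  T-vanishes (suc i) (suc b) (inj₂ lt) =
    T-vanishes i b (inj₂ (ℕ.≤-pred (subst (_< suc i) (ℕ.+-suc K b) lt)))

  module _ (αβ≈Q : α * β ≈ Q) where

    -- This is τ (k + 1) = α Q^k τ k for k = i - b = a - j, multiplied by Q^j to avoid negative
    -- exponents. For negative k it rests on α β = Q.
    T-sucˡ : ∀ i j a b → i ℕ.+ j ≡ a ℕ.+ b → Q ^ j * T (suc i) b ≈ α * Q ^ a * T i b
    T-sucˡ i j a zero i+j≡a+b = begin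
      Q ^ j * (theta α i * (α * Q ^ i))
        ≈⟨ solve 4 (λ u v w z → u :* (v :* (w :* z)) := w :* (z :* u) :* v) refl _ _ _ _ ⟩
      α * (Q ^ i * Q ^ j) * theta α i
        ≈⟨ *-cong (*-congˡ (sym (^-homo-* Q i j))) (reflexive (≡.sym (T-zero i))) ⟩
      α * Q ^ (i ℕ.+ j) * T i 0
        ≡⟨ ≡.cong (λ n → α * Q ^ n * T i 0) (≡.trans i+j≡a+b (ℕ.+-identityʳ a)) ⟩
      α * Q ^ a * T i 0 ∎
    T-sucˡ zero .(a ℕ.+ suc b) a (suc b) ≡.refl = begin
      Q ^ (a ℕ.+ suc b) * theta β b
        ≈⟨ *-congʳ (^-homo-* Q a (suc b)) ⟩
      Q ^ a * (Q * Q ^ b) * theta β b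
        ≈⟨ *-congʳ (*-congˡ (*-congʳ αβ≈Q)) ⟨
      Q ^ a * (α * β * Q ^ b) * theta β b
        ≈⟨ solve 5 (λ u v w z t → u :* (v :* w :* z) :* t := v :* u :* (t :* (w :* z))) refl _ _ _ _ _ ⟩
      α * Q ^ a * T 0 (suc b) ∎
    T-sucˡ (suc i) j a (suc b) i+j≡a+b =
      T-sucˡ i j a b (ℕ.suc-injective (≡.trans i+j≡a+b (ℕ.+-suc a b)))

    -- The same relation downwards, τ (k - 1) = β Q^(-k) τ k for k = i - b, multiplied by Q^i.
    T-sucʳ : ∀ i b → Q ^ i * T i (suc b) ≈ β * Q ^ b * T i b
    T-sucʳ zero    b    = solve 3 (λ u v w → con (+ 1) :* (u :* (v :* w)) := v :* w :* u) refl _ _ _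
    T-sucʳ (suc i) zero = begin
      Q * Q ^ i * T i 0                    ≈⟨ *-cong (*-congʳ (sym αβ≈Q)) (reflexive (T-zero i)) ⟩
      α * β * Q ^ i * theta α i
        ≈⟨ solve 4 (λ u v w z → u :* v :* w :* z := v :* con (+ 1) :* (z :* (u :* w))) refl _ _ _ _ ⟩
      β * 1# * (theta α i * (α * Q ^ i))   ∎
    T-sucʳ (suc i) (suc b) = begin
      Q * Q ^ i * T i (suc b)     ≈⟨ *-assoc _ _ _ ⟩
      Q * (Q ^ i * T i (suc b))   ≈⟨ *-congˡ (T-sucʳ i b) ⟩
      Q * (β * Q ^ b * T i b)
        ≈⟨ solve 4 (λ u v w z → u :* (v :* w :* z) := v :* (u :* w) :* z) refl _ _ _ _ ⟩
      β * (Q * Q ^ b) * T i b     ∎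

    -- For w i b = z^(i - b) this is the product of the factors 1 + z α Q^n for n < a and 1 + β Q^n
    -- / z for n < b.
    Laurent : ℕ → ℕ → (ℕ → ℕ → Carrier) → Carrier
    Laurent a b w = Λ (a ℕ.+ b) (λ i → T i b * w i b)

    -- The new factor is 1 + z α Q^a; multiplication by z acts on weights as a shift of `i`.
    Laurent-sucˡ : ∀ a b w → Laurent (suc a) b w ≈
                   Laurent a b w + α * Q ^ a * Laurent a b (λ i b → w (suc i) b)
    Laurent-sucˡ a b w = trans (Λ-pascalʳ (a ℕ.+ b) _) (+-congˡ
      (Λ-scale (a ℕ.+ b) (α * Q ^ a) (λ i j eq → trans (sym (*-assoc _ _ _))
        (trans (*-congʳ (T-sucˡ i j a b eq)) (*-assoc _ _ _)))))

    Laurent-sucʳ : ∀ b w → Laurent 0 (suc b) w ≈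
                   β * Q ^ b * Laurent 0 b (λ i b → w i (suc b)) + Laurent 0 b (λ i b → w (suc i) (suc b))
    Laurent-sucʳ b w = trans (Λ-pascalˡ b _) (+-congʳ
      (Λ-scale b (β * Q ^ b) (λ i j eq → trans (sym (*-assoc _ _ _))
        (trans (*-congʳ (T-sucʳ i b)) (*-assoc _ _ _)))))

    -- The weights s^k and s^k (1 + d k), k = i - b: the Laurent polynomial and its derivative at z = s.
    module Weighted (s : Carrier) (s²≈1 : s * s ≈ 1#) (d : ℤ) where

      slope : ℕ → ℕ → ℤ
      slope i b = + 1 ℤ.+ d ℤ.* (+ i ℤ.- + b)

      -- Since s² = 1, the power s^(i + b) serves as s^(i - b).
      w₀ w₁ : ℕ → ℕ → Carrier
      w₀ i b = s ^ (i ℕ.+ b)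
      w₁ i b = w₀ i b * ι (slope i b)

      w₀-sucʳ : ∀ i b → w₀ i (suc b) ≈ s * w₀ i b
      w₀-sucʳ i b = reflexive (≡.cong (s ^_) (ℕ.+-suc i b))

      slope-sucˡ : ∀ i b → ι (slope (suc i) b) ≈ ι (slope i b) + ι d
      slope-sucˡ i b = trans (reflexive (≡.cong ι (lemma d (+ i) (+ b)))) (ι-+ (slope i b) d)
        where
        lemma : ∀ d x y → + 1 ℤ.+ d ℤ.* (+ 1 ℤ.+ x ℤ.- y) ≡ + 1 ℤ.+ d ℤ.* (x ℤ.- y) ℤ.+ d
        lemma = solve-∀

      slope-sucʳ : ∀ i b → ι (slope i (suc b)) ≈ ι (slope i b) - ι d
      slope-sucʳ i b = trans (reflexive (≡.cong ι (lemma d (+ i) (+ b))))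
        (trans (ι-+ (slope i b) (ℤ.- d)) (+-congˡ (ι-neg d)))
        where
        lemma : ∀ d x y → + 1 ℤ.+ d ℤ.* (x ℤ.- (+ 1 ℤ.+ y)) ≡ + 1 ℤ.+ d ℤ.* (x ℤ.- y) ℤ.+ (ℤ.- d)
        lemma = solve-∀

      slope-suc² : ∀ i b → ι (slope (suc i) (suc b)) ≈ ι (slope i b)
      slope-suc² i b = trans (slope-sucˡ i (suc b)) (trans (+-congʳ (slope-sucʳ i b))
        (solve 2 (λ x y → x :- y :+ y := x) refl _ _))

      w₀-suc² : ∀ i b → w₀ (suc i) (suc b) ≈ w₀ i b
      w₀-suc² i b = trans (*-congˡ (w₀-sucʳ i b)) (trans (sym (*-assoc _ _ _))
        (trans (*-congʳ s²≈1) (*-identityˡ _)))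

      V₀ V₁ : ℕ → ℕ → Carrier
      V₀ a b = Laurent a b w₀
      V₁ a b = Laurent a b w₁

      V₀-sucˡ : ∀ a b → V₀ (suc a) b ≈ V₀ a b * (1# + s * (α * Q ^ a))
      V₀-sucˡ a b = begin
        V₀ (suc a) b
          ≈⟨ Laurent-sucˡ a b w₀ ⟩
        V₀ a b + α * Q ^ a * Λ (a ℕ.+ b) (λ i → T i b * w₀ (suc i) b)
          ≈⟨ +-congˡ (*-congˡ (Λ-linear (a ℕ.+ b) s 0# {g = λ _ → 0#} (λ i →
               solve 3 (λ t s w → t :* (s :* w) := s :* (t :* w) :+ con (+ 0) :* con (+ 0)) refl _ _ _))) ⟩
        V₀ a b + α * Q ^ a * (s * V₀ a b + 0# * _)
          ≈⟨ solve 4 (λ v x s z → v :+ x :* (s :* v :+ con (+ 0) :* z)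
                      := v :* (con (+ 1) :+ s :* x)) refl _ _ _ _ ⟩
        V₀ a b * (1# + s * (α * Q ^ a)) ∎

      -- Leibniz rule for the operator 1 + d z d/dz at z = s: the last summand differentiates the
      -- new factor. In `V₁-sucʳ` the factor involves 1/z, whence the opposite sign.
      V₁-sucˡ : ∀ a b → V₁ (suc a) b ≈
                V₁ a b * (1# + s * (α * Q ^ a)) + ι d * (s * (α * Q ^ a)) * V₀ a b
      V₁-sucˡ a b = begin
        V₁ (suc a) b
          ≈⟨ Laurent-sucˡ a b w₁ ⟩
        V₁ a b + α * Q ^ a * Λ (a ℕ.+ b) (λ i → T i b * w₁ (suc i) b)
          ≈⟨ +-congˡ (*-congˡ (Λ-linear (a ℕ.+ b) s (s * ι d) (λ i →
               trans (*-congˡ (*-congˡ (slope-sucˡ i b)))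
                 (solve 5 (λ t s w c d → t :* (s :* w :* (c :+ d)) :=
                           s :* (t :* (w :* c)) :+ s :* d :* (t :* w)) refl _ _ _ _ _)))) ⟩
        V₁ a b + α * Q ^ a * (s * V₁ a b + s * ι d * V₀ a b)
          ≈⟨ solve 5 (λ v x s d u → v :+ x :* (s :* v :+ s :* d :* u)
                      := v :* (con (+ 1) :+ s :* x) :+ d :* (s :* x) :* u) refl _ _ _ _ _ ⟩
        V₁ a b * (1# + s * (α * Q ^ a)) + ι d * (s * (α * Q ^ a)) * V₀ a b ∎

      V₀-sucʳ : ∀ b → V₀ 0 (suc b) ≈ V₀ 0 b * (1# + s * (β * Q ^ b))
      V₀-sucʳ b = begin
        V₀ 0 (suc b)
          ≈⟨ Laurent-sucʳ b w₀ ⟩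
        β * Q ^ b * Λ b (λ i → T i b * w₀ i (suc b)) + Λ b (λ i → T i b * w₀ (suc i) (suc b))
          ≈⟨ +-cong (*-congˡ (Λ-linear b s 0# {g = λ _ → 0#} (λ i → trans (*-congˡ (w₀-sucʳ i b))
               (solve 3 (λ t s w → t :* (s :* w) := s :* (t :* w) :+ con (+ 0) :* con (+ 0)) refl _ _ _))))
               (anti-cong b (λ i _ _ → *-congˡ (*-congˡ (w₀-suc² i b)))) ⟩
        β * Q ^ b * (s * V₀ 0 b + 0# * _) + V₀ 0 b
          ≈⟨ solve 4 (λ v x s z → x :* (s :* v :+ con (+ 0) :* z) :+ v
                      := v :* (con (+ 1) :+ s :* x)) refl _ _ _ _ ⟩
        V₀ 0 b * (1# + s * (β * Q ^ b)) ∎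

      V₁-sucʳ : ∀ b → V₁ 0 (suc b) ≈
                V₁ 0 b * (1# + s * (β * Q ^ b)) - ι d * (s * (β * Q ^ b)) * V₀ 0 b
      V₁-sucʳ b = begin
        V₁ 0 (suc b)
          ≈⟨ Laurent-sucʳ b w₁ ⟩
        β * Q ^ b * Λ b (λ i → T i b * w₁ i (suc b)) + Λ b (λ i → T i b * w₁ (suc i) (suc b))
          ≈⟨ +-cong (*-congˡ (Λ-linear b s (- (s * ι d)) (λ i →
               trans (*-congˡ (*-cong (w₀-sucʳ i b) (slope-sucʳ i b)))
                 (solve 5 (λ t s w c d → t :* (s :* w :* (c :- d)) :=
                           s :* (t :* (w :* c)) :+ (:- (s :* d)) :* (t :* w)) refl _ _ _ _ _))))
               (anti-cong b (λ i _ _ → *-congˡ (*-congˡ (*-cong (w₀-suc² i b) (slope-suc² i b))))) ⟩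
        β * Q ^ b * (s * V₁ 0 b + - (s * ι d) * V₀ 0 b) + V₁ 0 b
          ≈⟨ solve 5 (λ v x s d u → x :* (s :* v :+ (:- (s :* d)) :* u) :+ v
                      := v :* (con (+ 1) :+ s :* x) :- d :* (s :* x) :* u) refl _ _ _ _ _ ⟩
        V₁ 0 b * (1# + s * (β * Q ^ b)) - ι d * (s * (β * Q ^ b)) * V₀ 0 b ∎

      V₀-00 : V₀ 0 0 ≈ 1#
      V₀-00 = trans (*-congʳ (G-0ˡ 0)) (solve 0 (con (+ 1) :* (con (+ 1) :* con (+ 1)) := con (+ 1)) refl)

      V₁-00 : V₁ 0 0 ≈ 1#
      V₁-00 = trans (*-congʳ (G-0ˡ 0)) (trans (*-congˡ (*-congˡ (*-congˡ
          (reflexive (≡.cong (λ z → ι (+ 1 ℤ.+ z)) (ℤ.*-zeroʳ d))))))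
        (solve 0 (con (+ 1) :* (con (+ 1) :* (con (+ 1) :* con (+ 1))) := con (+ 1)) refl))

      V₀-product : ∀ a b → V₀ a b ≈ prod b (λ i → 1# + s * (β * Q ^ i)) * prod a (λ i → 1# + s * (α * Q ^ i))
      V₀-product zero    zero    = trans V₀-00 (sym (*-identityˡ _))
      V₀-product zero    (suc b) = trans (V₀-sucʳ b) (trans (*-congʳ (V₀-product 0 b))
        (solve 2 (λ x y → x :* con (+ 1) :* y := x :* y :* con (+ 1)) refl _ _))
      V₀-product (suc a) b = trans (V₀-sucˡ a b) (trans (*-congʳ (V₀-product a b)) (*-assoc _ _ _))

  Φ⁻¹-limit : ∀ {n} → K ≤ n → Φ⁻¹ n ≈ Φ⁻¹ K
  Φ⁻¹-limit {n} K≤n = begin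
    Φ⁻¹ n                     ≈⟨ *-identityʳ _ ⟨
    Φ⁻¹ n * 1#                ≈⟨ *-congˡ (Φ-inverse K) ⟨
    Φ⁻¹ n * (Φ K * Φ⁻¹ K)     ≈⟨ *-congˡ (*-congʳ (Φ-limit K≤n)) ⟨
    Φ⁻¹ n * (Φ n * Φ⁻¹ K)     ≈⟨ solve 3 (λ x y z → x :* (y :* z) := y :* x :* z) refl _ _ _ ⟩
    Φ n * Φ⁻¹ n * Φ⁻¹ K       ≈⟨ *-congʳ (Φ-inverse n) ⟩
    1# * Φ⁻¹ K                ≈⟨ *-identityˡ _ ⟩
    Φ⁻¹ K                     ∎

  G-limit : ∀ {i j} → K ≤ i → K ≤ j → Φ K * G i j ≈ 1#
  G-limit {i} {j} K≤i K≤j = begin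
    Φ K * (Φ (i ℕ.+ j) * Φ⁻¹ i * Φ⁻¹ j)
      ≈⟨ *-congˡ (*-cong (*-cong (Φ-limit (ℕ.m≤n⇒m≤n+o j K≤i)) (Φ⁻¹-limit K≤i)) (Φ⁻¹-limit K≤j)) ⟩
    Φ K * (Φ K * Φ⁻¹ K * Φ⁻¹ K)
      ≈⟨ solve 2 (λ x y → x :* (x :* y :* y) := x :* y :* (x :* y)) refl _ _ ⟩
    Φ K * Φ⁻¹ K * (Φ K * Φ⁻¹ K)
      ≈⟨ *-cong (Φ-inverse K) (Φ-inverse K) ⟩
    1# * 1#
      ≈⟨ *-identityˡ _ ⟩
    1# ∎

  -- If i and j are both at least K, the q-binomial coefficient is 1 / `Φ K`; otherwise i lies more
  -- than K away from M and `T i M` is zero. The choice M = 2K leaves room on both sides.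
  Laurent-limit : ∀ (w : ℕ → Carrier) → let M = K ℕ.+ K in
    Φ K * Λ (M ℕ.+ M) (λ i → T i M * w i) ≈ anti (M ℕ.+ M) (λ i _ → T i M * w i)
  Laurent-limit w = trans (sym (anti-* (M ℕ.+ M) (Φ K) (λ i j → G i j * (T i M * w i)))) (anti-cong (M ℕ.+ M) term)
    where
    M = K ℕ.+ K
    vanish : ∀ x y z {t} → t ≈ 0# → x * (y * (t * z)) ≈ t * z
    vanish x y z {t} t≈0 = begin
      x * (y * (t * z))   ≈⟨ solve 4 (λ t x y z → x :* (y :* (t :* z)) := t :* (x :* y :* z)) refl _ _ _ _ ⟩
      t * (x * y * z)     ≈⟨ *-congʳ t≈0 ⟩
      0# * (x * y * z)    ≈⟨ zeroˡ _ ⟩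
      0#                  ≈⟨ zeroˡ _ ⟨
      0# * z              ≈⟨ *-congʳ t≈0 ⟨
      t * z               ∎
    term : ∀ i j → i ℕ.+ j ≡ M ℕ.+ M → Φ K * (G i j * (T i M * w i)) ≈ T i M * w i
    term i j eq with K ℕ.≤? i | K ℕ.≤? j
    ... | no K≰i | _ = vanish (Φ K) (G i j) (w i) (T-vanishes i M (inj₁ (ℕ.+-monoʳ-< K (ℕ.≰⇒> K≰i))))
    ... | yes _ | no K≰j = vanish (Φ K) (G i j) (w i) (T-vanishes i M (inj₂ (far-right eq (ℕ.≰⇒> K≰j))))
    ... | yes K≤i | yes K≤j = trans (sym (*-assoc _ _ _)) (trans (*-congʳ (G-limit K≤i K≤j)) (*-identityˡ _))

-- Theta identities: Jacobi's cube and the two-square series.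

χ : ℕ → ℤ
χ 0 = + 0
χ 1 = + 1
χ 2 = + 0
χ 3 = ℤ.- (+ 1)
χ (suc (suc (suc (suc n)))) = χ n

module Identities {R : CommutativeRing 0ℓ 0ℓ} (scalars : IntegerScalars R) (k : ℕ)
  (q : CommutativeRing.Carrier R)
  (q-nilpotent : CommutativeRing._≈_ R (Products._^_ scalars q (suc k)) (CommutativeRing.0# R)) where
  open CommutativeRing R
  open Products scalars
  open import Relation.Binary.Reasoning.Setoid setoid

  K M : ℕ
  K = suc k
  M = K ℕ.+ K

  K≤M : K ≤ M
  K≤M = ℕ.m≤m+n K K

  power-nilpotent : ∀ m → (q ^ suc m) ^ K ≈ 0#
  power-nilpotent m = ^-zero-* {q} {K} m q-nilpotent

  module Triple (m : ℕ) (α β : Carrier) = FiniteTripleProduct scalars K (q ^ suc m) α β (power-nilpotent m)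

  -- E m is ∏ (1 - q^((m+1)n)), n ≥ 1; the parameters α and β of Triple do not enter Φ.
  E E⁻¹ : ℕ → Carrier
  E   m = Triple.Φ m 0# 0# K
  E⁻¹ m = Triple.Φ⁻¹ m 0# 0# K

  E-inverse : ∀ m → E m * E⁻¹ m ≈ 1#
  E-inverse m = Triple.Φ-inverse m 0# 0# K

  -1*-1≈1 : - 1# * - 1# ≈ 1#
  -1*-1≈1 = solve 0 ((:- con (+ 1)) :* (:- con (+ 1)) := con (+ 1)) refl

  module Jacobi (m : ℕ) where
    private x = q ^ suc m
    open Triple m x 1# public
    open Weighted (*-identityʳ x) (- 1#) -1*-1≈1 (+ 2) public

    -- With β = 1 and s = -1 the first factor in β is 1 - 1.
    V₀-vanishes : ∀ a b → V₀ a (suc b) ≈ 0#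
    V₀-vanishes zero    zero    = trans (V₀-sucʳ 0) (solve 1 (λ v →
      v :* (con (+ 1) :+ (:- con (+ 1)) :* (con (+ 1) :* con (+ 1))) := con (+ 0)) refl _)
    V₀-vanishes zero    (suc b) = trans (V₀-sucʳ (suc b)) (trans (*-congʳ (V₀-vanishes 0 b)) (zeroˡ _))
    V₀-vanishes (suc a) b       = trans (V₀-sucˡ a (suc b)) (trans (*-congʳ (V₀-vanishes a b)) (zeroˡ _))

    -- At a zero of the product only the derivative of the vanishing factor survives, and it
    -- contributes d = 2. The other factors in β form `Φ b`, those in α form `Φ a`.
    V₁-product : ∀ a b → V₁ a (suc b) ≈ ι (+ 2) * (Φ b * Φ a)
    V₁-product zero    zero    = begin
      V₁ 0 1
        ≈⟨ V₁-sucʳ 0 ⟩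
      V₁ 0 0 * (1# + - 1# * (1# * 1#)) - ι (+ 2) * (- 1# * (1# * 1#)) * V₀ 0 0
        ≈⟨ +-congˡ (-‿cong (*-congˡ V₀-00)) ⟩
      V₁ 0 0 * (1# + - 1# * (1# * 1#)) - ι (+ 2) * (- 1# * (1# * 1#)) * 1#
        ≈⟨ solve 1 (λ v → v :* (con (+ 1) :+ (:- con (+ 1)) :* (con (+ 1) :* con (+ 1)))
             :- con (+ 2) :* ((:- con (+ 1)) :* (con (+ 1) :* con (+ 1))) :* con (+ 1)
             := con (+ 2) :* (con (+ 1) :* con (+ 1))) refl _ ⟩
      ι (+ 2) * (Φ 0 * Φ 0) ∎
    V₁-product zero    (suc b) = begin
      V₁ 0 (suc (suc b))
        ≈⟨ V₁-sucʳ (suc b) ⟩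
      V₁ 0 (suc b) * (1# + - 1# * (1# * y)) - ι (+ 2) * (- 1# * (1# * y)) * V₀ 0 (suc b)
        ≈⟨ +-cong (*-congʳ (V₁-product 0 b)) (-‿cong (*-congˡ (V₀-vanishes 0 b))) ⟩
      ι (+ 2) * (Φ b * Φ 0) * (1# + - 1# * (1# * y)) - ι (+ 2) * (- 1# * (1# * y)) * 0#
        ≈⟨ solve 2 (λ f y → con (+ 2) :* (f :* con (+ 1)) :* (con (+ 1) :+ (:- con (+ 1)) :* (con (+ 1) :* y))
             :- con (+ 2) :* ((:- con (+ 1)) :* (con (+ 1) :* y)) :* con (+ 0)
             := con (+ 2) :* (f :* (con (+ 1) :- y) :* con (+ 1))) refl _ _ ⟩
      ι (+ 2) * (Φ (suc b) * Φ 0) ∎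
      where y = x ^ suc b
    V₁-product (suc a) b = begin
      V₁ (suc a) (suc b)
        ≈⟨ V₁-sucˡ a (suc b) ⟩
      V₁ a (suc b) * (1# + - 1# * y) + ι (+ 2) * (- 1# * y) * V₀ a (suc b)
        ≈⟨ +-cong (*-congʳ (V₁-product a b)) (*-congˡ (V₀-vanishes a b)) ⟩
      ι (+ 2) * (Φ b * Φ a) * (1# + - 1# * y) + ι (+ 2) * (- 1# * y) * 0#
        ≈⟨ solve 3 (λ f g y → con (+ 2) :* (f :* g) :* (con (+ 1) :+ (:- con (+ 1)) :* y)
             :+ con (+ 2) :* ((:- con (+ 1)) :* y) :* con (+ 0)
             := con (+ 2) :* (f :* (g :* (con (+ 1) :- y)))) refl _ _ _ ⟩
      ι (+ 2) * (Φ b * Φ (suc a)) ∎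
      where y = x ^ suc a

    Θ : Carrier
    Θ = anti (M ℕ.+ M) (λ i _ → T i M * w₁ i M)

    jacobi : ι (+ 2) * (E m * E m * E m) ≈ Θ
    jacobi = begin
      ι (+ 2) * (E m * E m * E m)
        ≈⟨ solve 2 (λ t e → t :* (e :* e :* e) := e :* (t :* (e :* e))) refl _ _ ⟩
      E m * (ι (+ 2) * (E m * E m))
        -- `M` is `suc (k + K)`: the vanishing factor uses up one of the M factors in β, and k + K
        -- remain.
        ≈⟨ *-congˡ (*-congˡ (*-cong (Φ-limit (ℕ.m≤n+m K k)) (Φ-limit K≤M))) ⟨
      E m * (ι (+ 2) * (Φ (k ℕ.+ K) * Φ M))
        ≈⟨ *-congˡ (V₁-product M (k ℕ.+ K)) ⟨
      Φ K * V₁ M M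
        ≈⟨ Laurent-limit (λ i → w₁ i M) ⟩
      Θ ∎

  sum : ℕ → (ℕ → Carrier) → Carrier
  sum zero    f = 0#
  sum (suc n) f = sum n f + f n

  sum-difference : ∀ n f g → sum n f - sum n g ≈ sum n (λ i → f i - g i)
  sum-difference zero    f g = solve 0 (con (+ 0) :- con (+ 0) := con (+ 0)) refl
  sum-difference (suc n) f g = trans
    (solve 4 (λ a b c d → a :+ b :- (c :+ d) := a :- c :+ (b :- d)) refl _ _ _ _)
    (+-congʳ (sum-difference n f g))

  sum-extend : ∀ {f N} → (∀ i → N ≤ i → f i ≈ 0#) → ∀ {n} → N ≤ n → sum n f ≈ sum N f
  sum-extend {f} {N} p N≤n = go (ℕ.≤⇒≤′ N≤n)
    where
    go : ∀ {n} → N ℕ.≤′ n → sum n f ≈ sum N f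
    go (ℕ.≤′-reflexive ≡.refl) = refl
    go (ℕ.≤′-step N≤′n) = trans (+-cong (go N≤′n) (p _ (ℕ.≤′⇒≤ N≤′n))) (+-identityʳ _)

  L : ℕ → Carrier
  L n = ι (χ n) * lambert K (q ^ n)

  L-vanishes : ∀ {n} → K ≤ n → L n ≈ 0#
  L-vanishes {n} K≤n = trans (*-congˡ (begin
    l                        ≈⟨ solve 2 (λ l x → l := l :* (con (+ 1) :+ x) :- l :* x) refl l x ⟩
    l * (1# + x) - l * x     ≈⟨ +-congʳ (lambert-* {K} {x} (trans (^-congˡ K x≈0) (zeroˡ _))) ⟩
    x - l * x                ≈⟨ +-cong x≈0 (-‿cong (*-congˡ x≈0)) ⟩
    0# - l * 0#              ≈⟨ solve 1 (λ l → con (+ 0) :- l :* con (+ 0) := con (+ 0)) refl l ⟩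
    0#                       ∎)) (zeroʳ _)
    where
    x = q ^ n
    l = lambert K x
    x≈0 : x ≈ 0#
    x≈0 = ^-zero-≤ {q} {K} q-nilpotent K≤n

  S : Carrier
  S = sum K (λ i → L (suc i))

  -- By Jacobi's two-square theorem at -q, the series 1 - 4S is the square of Σ (-1)^n q^(n²), n ∈
  -- ℤ; hence the name.
  module TwoSquares where
    open Triple 3 (q ^ 3) (q ^ 1) public
    open Weighted (sym (^-homo-* q 3 1)) 1# (*-identityˡ 1#) (+ 4) public

    private
      Q = q ^ 4
      x y : ℕ → Carrier
      x i = q ^ 3 * Q ^ i
      y i = q ^ 1 * Q ^ i

      x≈ : ∀ i → x i ≈ q ^ (3 ℕ.+ 4 ℕ.* i)
      x≈ i = trans (*-congˡ (^-assocʳ q 4 i)) (sym (^-homo-* q 3 (4 ℕ.* i)))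

      y≈ : ∀ i → y i ≈ q ^ (1 ℕ.+ 4 ℕ.* i)
      y≈ i = trans (*-congˡ (^-assocʳ q 4 i)) (sym (^-homo-* q 1 (4 ℕ.* i)))

      u v : ℕ → Carrier
      u i = lambert K (q ^ (3 ℕ.+ 4 ℕ.* i))
      v i = lambert K (q ^ (1 ℕ.+ 4 ℕ.* i))

      u-* : ∀ i → u i * (1# + x i) ≈ x i
      u-* i = trans (*-congˡ (+-congˡ (x≈ i)))
        (trans (lambert-* {K} (power-nilpotent (2 ℕ.+ 4 ℕ.* i))) (sym (x≈ i)))

      v-* : ∀ i → v i * (1# + y i) ≈ y i
      v-* i = trans (*-congˡ (+-congˡ (y≈ i)))
        (trans (lambert-* {K} (power-nilpotent (4 ℕ.* i))) (sym (y≈ i)))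

    -- At s = 1 all factors are units, so V₁ / V₀ is 1 + 4 times a logarithmic derivative. A factor
    -- 1 + x contributes x / (1 + x), positively for the exponents 3 modulo 4 in α and negatively
    -- for the exponents 1 modulo 4 in β: this is where the character comes from.
    V₁-logarithmic : ∀ a b → V₁ a b ≈ V₀ a b * (1# - ι (+ 4) * (sum b v - sum a u))
    V₁-logarithmic zero zero = trans V₁-00 (trans
      (solve 0 (con (+ 1) := con (+ 1) :* (con (+ 1) :- con (+ 4) :* (con (+ 0) :- con (+ 0)))) refl)
      (*-congʳ (sym V₀-00)))
    V₁-logarithmic zero (suc b) = begin
      V₁ 0 (suc b)
        ≈⟨ V₁-sucʳ b ⟩
      V₁ 0 b * (1# + 1# * y b) - ι (+ 4) * (1# * y b) * V₀ 0 b
        ≈⟨ +-cong (*-congʳ (V₁-logarithmic 0 b))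
             (-‿cong (*-congʳ (*-congˡ (*-congˡ (sym (v-* b)))))) ⟩
      V₀ 0 b * (1# - ι (+ 4) * (sum b v - 0#)) * (1# + 1# * y b)
        - ι (+ 4) * (1# * (v b * (1# + y b))) * V₀ 0 b
        ≈⟨ solve 4 (λ V y v s →
             V :* (con (+ 1) :- con (+ 4) :* (s :- con (+ 0))) :* (con (+ 1) :+ con (+ 1) :* y)
               :- con (+ 4) :* (con (+ 1) :* (v :* (con (+ 1) :+ y))) :* V
             := V :* (con (+ 1) :+ con (+ 1) :* y) :* (con (+ 1) :- con (+ 4) :* (s :+ v :- con (+ 0))))
             refl _ _ _ _ ⟩
      V₀ 0 b * (1# + 1# * y b) * (1# - ι (+ 4) * (sum (suc b) v - 0#))
        ≈⟨ *-congʳ (V₀-sucʳ b) ⟨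
      V₀ 0 (suc b) * (1# - ι (+ 4) * (sum (suc b) v - 0#)) ∎
    V₁-logarithmic (suc a) b = begin
      V₁ (suc a) b
        ≈⟨ V₁-sucˡ a b ⟩
      V₁ a b * (1# + 1# * x a) + ι (+ 4) * (1# * x a) * V₀ a b
        ≈⟨ +-cong (*-congʳ (V₁-logarithmic a b)) (*-congʳ (*-congˡ (*-congˡ (sym (u-* a))))) ⟩
      V₀ a b * (1# - ι (+ 4) * (sum b v - sum a u)) * (1# + 1# * x a)
        + ι (+ 4) * (1# * (u a * (1# + x a))) * V₀ a b
        ≈⟨ solve 5 (λ V x u s t →
             V :* (con (+ 1) :- con (+ 4) :* (s :- t)) :* (con (+ 1) :+ con (+ 1) :* x)
               :+ con (+ 4) :* (con (+ 1) :* (u :* (con (+ 1) :+ x))) :* V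
             := V :* (con (+ 1) :+ con (+ 1) :* x) :* (con (+ 1) :- con (+ 4) :* (s :- (t :+ u))))
             refl _ _ _ _ _ ⟩
      V₀ a b * (1# + 1# * x a) * (1# - ι (+ 4) * (sum b v - sum (suc a) u))
        ≈⟨ *-congʳ (V₀-sucˡ a b) ⟨
      V₀ (suc a) b * (1# - ι (+ 4) * (sum b v - sum (suc a) u)) ∎

    sum-by-residue : ∀ n → sum (n ℕ.* 4) (λ i → L (suc i)) ≈ sum n v - sum n u
    sum-by-residue n = trans (go n) (sym (sum-difference n v u))
      where
      χ-periodic : ∀ r i → χ (i ℕ.* 4 ℕ.+ r) ≡ χ r
      χ-periodic r zero    = ≡.refl
      χ-periodic r (suc i) = χ-periodic r i

      Lᵣ : ∀ r i → L (i ℕ.* 4 ℕ.+ r) ≈ ι (χ r) * lambert K (q ^ (r ℕ.+ 4 ℕ.* i))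
      Lᵣ r i = reflexive (≡.cong₂ (λ c e → ι c * lambert K (q ^ e)) (χ-periodic r i) (lemma i r))
        where
        lemma : ∀ i r → i ℕ.* 4 ℕ.+ r ≡ r ℕ.+ 4 ℕ.* i
        lemma = ℕ-Solver.solve-∀

      shift : ∀ i r → L (r ℕ.+ i ℕ.* 4) ≈ ι (χ r) * lambert K (q ^ (r ℕ.+ 4 ℕ.* i))
      shift i r = trans (reflexive (≡.cong L (ℕ.+-comm r (i ℕ.* 4)))) (Lᵣ r i)

      go : ∀ n → sum (n ℕ.* 4) (λ i → L (suc i)) ≈ sum n (λ i → v i - u i)
      go zero    = refl
      go (suc n) = begin
        sum (n ℕ.* 4) (λ i → L (suc i)) + L (1 ℕ.+ n ℕ.* 4) + L (2 ℕ.+ n ℕ.* 4)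
          + L (3 ℕ.+ n ℕ.* 4) + L (4 ℕ.+ n ℕ.* 4)
          ≈⟨ +-cong (+-cong (+-cong (+-cong (go n) (shift n 1)) (shift n 2)) (shift n 3)) (shift n 4) ⟩
        sum n (λ i → v i - u i) + 1# * v n + 0# * _ + ι (ℤ.- (+ 1)) * u n + 0# * _
          ≈⟨ solve 5 (λ s v u a b → s :+ con (+ 1) :* v :+ con (+ 0) :* a :+ con (ℤ.- (+ 1)) :* u
               :+ con (+ 0) :* b := s :+ (v :- u)) refl _ _ _ _ _ ⟩
        sum n (λ i → v i - u i) + (v n - u n) ∎

    S-by-residue : S ≈ sum M v - sum M u
    S-by-residue = trans (sym (sum-extend (λ i K≤i → L-vanishes (ℕ.m≤n⇒m≤1+n K≤i))
        (ℕ.≤-trans K≤M (ℕ.m≤m*n M 4)))) (sum-by-residue M)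

    Θ : Carrier
    Θ = anti (M ℕ.+ M) (λ i _ → T i M * w₁ i M)

    -- Gauss's series Σ q^(n(n+1)/2), n ≥ 0, in the product form given by the triple product at z =
    -- 1.
    ψ : Carrier
    ψ = prod M (λ i → 1# + 1# * y i) * prod M (λ i → 1# + 1# * x i) * E 3

    two-squares : ψ * (1# - ι (+ 4) * S) ≈ Θ
    two-squares = begin
      ψ * (1# - ι (+ 4) * S)
        ≈⟨ *-cong (trans (*-congʳ (sym (V₀-product M M))) (*-comm _ _))
                  (+-congˡ (-‿cong (*-congˡ S-by-residue))) ⟩
      Φ K * V₀ M M * (1# - ι (+ 4) * (sum M v - sum M u))
        ≈⟨ *-assoc _ _ _ ⟩
      Φ K * (V₀ M M * (1# - ι (+ 4) * (sum M v - sum M u)))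
        ≈⟨ *-congˡ (V₁-logarithmic M M) ⟨
      Φ K * V₁ M M
        ≈⟨ Laurent-limit (λ i → w₁ i M) ⟩
      Θ ∎

    private
      neg pos : ℕ → ℕ → ℕ → Carrier
      neg r s i = 1# - q ^ (r ℕ.+ s ℕ.* i)
      pos r s i = 1# + q ^ (r ℕ.+ s ℕ.* i)

      E≈ : ∀ m {n} → K ≤ n → E m ≈ prod n (neg (suc m) (suc m))
      E≈ m {n} K≤n = trans (sym (Triple.Φ-limit m 0# 0# K≤n)) (prod-cong n (λ i →
        +-congˡ (-‿cong (trans (^-assocʳ q (suc m) (suc i)) (reflexive (≡.cong (q ^_) (ℕ.*-suc (suc m) i)))))))

      interleave : ∀ n {f g h} → (∀ i → f (i ℕ.* 2) ≈ g i) → (∀ i → f (suc (i ℕ.* 2)) ≈ h i) →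
                   prod (n ℕ.* 2) f ≈ prod n g * prod n h
      interleave n {f} p r = trans (prod-double n f)
        (trans (prod-cong n (λ i → *-cong (p i) (r i))) (sym (prod-* n _ _)))

      neg-cong : ∀ {a b} → a ≡ b → 1# - q ^ a ≈ 1# - q ^ b
      neg-cong ≡.refl = refl

      pos-cong : ∀ {a b} → a ≡ b → 1# + q ^ a ≈ 1# + q ^ b
      pos-cong ≡.refl = refl

    -- Both sides are ∏ (1 - q^(2n)) times ∏ (1 - q^(4n-2)) ∏ (1 - q^(4n)).
    E₁ψ≈E₂² : E 0 * ψ ≈ E 1 * E 1
    E₁ψ≈E₂² = begin
      E 0 * ψ
        ≈⟨ *-cong E₁-split (*-cong O⁺-join (E≈ 3 K≤M)) ⟩
      O * E 1 * (O⁺ * prod M (neg 4 4))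
        ≈⟨ solve 4 (λ a b c d → a :* b :* (c :* d) := a :* c :* d :* b) refl _ _ _ _ ⟩
      O * O⁺ * prod M (neg 4 4) * E 1
        ≈⟨ *-congʳ (*-congʳ (trans (prod-* (M ℕ.* 2) _ _) (prod-cong (M ℕ.* 2) square))) ⟩
      prod (M ℕ.* 2) (neg 2 4) * prod M (neg 4 4) * E 1
        -- Factors with i ≥ M have exponents beyond K and equal 1, so the second half of them drops
        -- out.
        ≈⟨ *-congʳ (*-congʳ (prod-extend neg-trivial (ℕ.m≤m*n M 2))) ⟩
      prod M (neg 2 4) * prod M (neg 4 4) * E 1
        ≈⟨ *-congʳ (interleave M {neg 2 2} (λ i → neg-cong (lemma₃ i)) (λ i → neg-cong (lemma₄ i))) ⟨
      prod (M ℕ.* 2) (neg 2 2) * E 1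
        ≈⟨ *-congʳ (E≈ 1 (ℕ.≤-trans K≤M (ℕ.m≤m*n M 2))) ⟨
      E 1 * E 1 ∎
      where
      O O⁺ : Carrier
      O  = prod (M ℕ.* 2) (neg 1 2)
      O⁺ = prod (M ℕ.* 2) (pos 1 2)
      lemma₁ : ∀ i → 1 ℕ.+ 1 ℕ.* (i ℕ.* 2) ≡ 1 ℕ.+ 2 ℕ.* i
      lemma₁ = ℕ-Solver.solve-∀
      lemma₂ : ∀ i → 1 ℕ.+ 1 ℕ.* (1 ℕ.+ i ℕ.* 2) ≡ 2 ℕ.+ 2 ℕ.* i
      lemma₂ = ℕ-Solver.solve-∀
      lemma₃ : ∀ i → 2 ℕ.+ 2 ℕ.* (i ℕ.* 2) ≡ 2 ℕ.+ 4 ℕ.* i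
      lemma₃ = ℕ-Solver.solve-∀
      lemma₄ : ∀ i → 2 ℕ.+ 2 ℕ.* (1 ℕ.+ i ℕ.* 2) ≡ 4 ℕ.+ 4 ℕ.* i
      lemma₄ = ℕ-Solver.solve-∀
      lemma₅ : ∀ i → 1 ℕ.+ 2 ℕ.* (i ℕ.* 2) ≡ 1 ℕ.+ 4 ℕ.* i
      lemma₅ = ℕ-Solver.solve-∀
      lemma₆ : ∀ i → 1 ℕ.+ 2 ℕ.* (1 ℕ.+ i ℕ.* 2) ≡ 3 ℕ.+ 4 ℕ.* i
      lemma₆ = ℕ-Solver.solve-∀
      lemma₇ : ∀ i → (1 ℕ.+ 2 ℕ.* i) ℕ.+ (1 ℕ.+ 2 ℕ.* i) ≡ 2 ℕ.+ 4 ℕ.* i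
      lemma₇ = ℕ-Solver.solve-∀
      E₁-split : E 0 ≈ O * E 1
      E₁-split = trans (E≈ 0 (ℕ.≤-trans K≤M (ℕ.≤-trans (ℕ.m≤m*n M 2) (ℕ.m≤m*n (M ℕ.* 2) 2))))
        (trans (interleave (M ℕ.* 2) {neg 1 1} (λ i → neg-cong (lemma₁ i)) (λ i → neg-cong (lemma₂ i)))
               (*-congˡ (sym (E≈ 1 (ℕ.≤-trans K≤M (ℕ.m≤m*n M 2))))))
      O⁺-join : prod M (λ i → 1# + 1# * y i) * prod M (λ i → 1# + 1# * x i) ≈ O⁺
      O⁺-join = sym (interleave M {pos 1 2}
        (λ i → trans (pos-cong (lemma₅ i)) (+-congˡ (trans (sym (y≈ i)) (sym (*-identityˡ _)))))
        (λ i → trans (pos-cong (lemma₆ i)) (+-congˡ (trans (sym (x≈ i)) (sym (*-identityˡ _))))))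
      square : ∀ i → neg 1 2 i * pos 1 2 i ≈ neg 2 4 i
      square i = trans
        (solve 1 (λ z → (con (+ 1) :- z) :* (con (+ 1) :+ z) := con (+ 1) :- z :* z) refl _)
        (+-congˡ (-‿cong (trans (sym (^-homo-* q (1 ℕ.+ 2 ℕ.* i) (1 ℕ.+ 2 ℕ.* i)))
          (reflexive (≡.cong (q ^_) (lemma₇ i))))))
      neg-trivial : ∀ i → M ≤ i → neg 2 4 i ≈ 1#
      neg-trivial i M≤i = trans (+-congˡ (-‿cong (^-zero-≤ {q} {K} q-nilpotent
          (ℕ.≤-trans (ℕ.≤-trans K≤M M≤i) (ℕ.≤-trans (ℕ.m≤n*m i 4) (ℕ.m≤n+m (4 ℕ.* i) 2))))))
        (solve 0 (con (+ 1) :- con (+ 0) := con (+ 1)) refl)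

  -- Reduction of the identities modulo 5.

  module CharacteristicFive (5≈0 : ι (+ 5) ≈ 0#) where

    frobenius : ∀ x → (1# - x) ^ 5 ≈ 1# - x ^ 5
    frobenius x = begin
      (1# - x) ^ 5
        -- The cofactor of 5 collects the middle terms -5x + 10x² - 10x³ + 5x⁴.
        ≈⟨ solve 1 (λ x → (con (+ 1) :- x) :^ 5 := con (+ 1) :- x :^ 5 :+ con (+ 5)
             :* (x :* x :* (con (+ 2) :- con (+ 2) :* x :+ x :* x) :- x)) refl x ⟩
      1# - x ^ 5 + ι (+ 5) * _
        ≈⟨ +-congˡ (trans (*-congʳ 5≈0) (zeroˡ _)) ⟩
      1# - x ^ 5 + 0#
        ≈⟨ +-identityʳ _ ⟩
      1# - x ^ 5 ∎

    -- Arguments of `E` are one below the mathematical index, and 5 (m + 1) = (4 + 5 m) + 1.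
    E-frobenius : ∀ m → E m * E m * E m * E m * E m ≈ E (4 ℕ.+ m ℕ.* 5)
    E-frobenius m = go K
      where
      f g : ℕ → Carrier
      f i = 1# - (q ^ suc m) ^ suc i
      g i = 1# - (q ^ (suc m ℕ.* 5)) ^ suc i
      step : ∀ i → f i ^ 5 ≈ g i
      step i = trans (frobenius _) (+-congˡ (-‿cong (begin
        ((q ^ suc m) ^ suc i) ^ 5     ≈⟨ ^-assocʳ (q ^ suc m) (suc i) 5 ⟩
        (q ^ suc m) ^ (suc i ℕ.* 5)   ≡⟨ ≡.cong ((q ^ suc m) ^_) (ℕ.*-comm (suc i) 5) ⟩
        (q ^ suc m) ^ (5 ℕ.* suc i)   ≈⟨ ^-assocʳ (q ^ suc m) 5 (suc i) ⟨
        ((q ^ suc m) ^ 5) ^ suc i     ≈⟨ ^-congˡ (suc i) (^-assocʳ q (suc m) 5) ⟩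
        (q ^ (suc m ℕ.* 5)) ^ suc i   ∎)))
      go : ∀ n → let p = prod n f in p * p * p * p * p ≈ prod n g
      go zero    = solve 0 (con (+ 1) :* con (+ 1) :* con (+ 1) :* con (+ 1) :* con (+ 1) := con (+ 1)) refl
      go (suc n) = trans (solve 2 (λ p x → let y = p :* x in y :* y :* y :* y :* y
                                := p :* p :* p :* p :* p :* x :^ 5) refl _ _)
                         (*-cong (go n) (step n))

    open TwoSquares using (ψ; two-squares; E₁ψ≈E₂²)

    -- Write 1 / E_1 as E_1⁹ / (E_1⁵)²: the numerator is a cube of E_1³, and each of the three
    -- factors costs a 2.
    partitions-expansion : ι (+ 8) * E⁻¹ 0 ≈ Jacobi.Θ 0 * Jacobi.Θ 0 * Jacobi.Θ 0 * (E⁻¹ 4 * E⁻¹ 4)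
    partitions-expansion = begin
      ι (+ 8) * P
        ≈⟨ solve 1 (λ p → con (+ 8) :* p := con (+ 8) :* (con (+ 1) :* con (+ 1)) :* p) refl _ ⟩
      ι (+ 8) * (1# * 1#) * P
        ≈⟨ *-congʳ (*-congˡ (*-cong (E-inverse 4) (E-inverse 4))) ⟨
      ι (+ 8) * (E 4 * u * (E 4 * u)) * P
        ≈⟨ *-congʳ (*-congˡ (*-cong (*-congʳ (E-frobenius 0)) (*-congʳ (E-frobenius 0)))) ⟨
      ι (+ 8) * (e * e * e * e * e * u * (e * e * e * e * e * u)) * P
        ≈⟨ solve 3 (λ e p u → let 2e³ = con (+ 2) :* (e :* e :* e) in
             con (+ 8) :* (e :* e :* e :* e :* e :* u :* (e :* e :* e :* e :* e :* u)) :* p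
             := 2e³ :* 2e³ :* 2e³ :* (e :* p) :* (u :* u)) refl _ _ _ ⟩
      2e³ * 2e³ * 2e³ * (e * P) * (u * u)
        ≈⟨ *-congʳ (trans (*-congˡ (E-inverse 0)) (*-identityʳ _)) ⟩
      2e³ * 2e³ * 2e³ * (u * u)
        ≈⟨ *-congʳ (*-cong (*-cong (Jacobi.jacobi 0) (Jacobi.jacobi 0)) (Jacobi.jacobi 0)) ⟩
      Jacobi.Θ 0 * Jacobi.Θ 0 * Jacobi.Θ 0 * (u * u) ∎
      where
      e = E 0 ; P = E⁻¹ 0 ; u = E⁻¹ 4
      2e³ = ι (+ 2) * (e * e * e)

    -- Since 1 / E_1 = ψ / E_2², the product P (1 - 4S) is the theta series divided by E_2²; a
    -- further E_2³ above and below completes the denominator to E_2⁵.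
    lambert-expansion : ι (+ 2) * (E⁻¹ 0 * (1# - ι (+ 4) * S)) ≈ TwoSquares.Θ * Jacobi.Θ 1 * E⁻¹ 9
    lambert-expansion = begin
      ι (+ 2) * (P * s)
        ≈⟨ *-identityʳ _ ⟨
      ι (+ 2) * (P * s) * 1#
        ≈⟨ *-congˡ (E-inverse 9) ⟨
      ι (+ 2) * (P * s) * (E 9 * u)
        ≈⟨ *-congˡ (*-congʳ (E-frobenius 1)) ⟨
      ι (+ 2) * (P * s) * (e * e * e * e * e * u)
        ≈⟨ solve 4 (λ e p s u → con (+ 2) :* (p :* s) :* (e :* e :* e :* e :* e :* u)
             := p :* s :* (e :* e) :* (con (+ 2) :* (e :* e :* e)) :* u) refl _ _ _ _ ⟩
      P * s * (e * e) * (ι (+ 2) * (e * e * e)) * u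
        ≈⟨ *-congʳ (*-cong (*-congˡ (sym E₁ψ≈E₂²)) (Jacobi.jacobi 1)) ⟩
      P * s * (E 0 * ψ) * Jacobi.Θ 1 * u
        ≈⟨ *-congʳ (*-congʳ (solve 4 (λ p s e ψ → p :* s :* (e :* ψ) := e :* p :* (ψ :* s)) refl _ _ _ _)) ⟩
      E 0 * P * (ψ * s) * Jacobi.Θ 1 * u
        ≈⟨ *-congʳ (*-congʳ (trans (*-cong (E-inverse 0) two-squares) (*-identityˡ _))) ⟩
      TwoSquares.Θ * Jacobi.Θ 1 * u ∎
      where
      e = E 1 ; P = E⁻¹ 0 ; u = E⁻¹ 9
      s = 1# - ι (+ 4) * S

-- Effect of a block of equal new parts on the unpaired parts.

module Blocks where
  open ≡ using (refl; sym; trans; cong; cong₂)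
  deduplicate-block : ∀ j k xs → All (k ≢_) xs →
    deduplicate _≟_ (replicate (suc j) k ++ xs) ≡ k ∷ deduplicate _≟_ xs
  deduplicate-block zero    k xs k∉xs =
    cong (k ∷_) (filter-all (¬? ∘ (k ≟_)) (All.deduplicate⁺ _≟_ k∉xs))
  deduplicate-block (suc j) k xs k∉xs = cong (k ∷_) (begin
    filter (¬? ∘ (k ≟_)) (deduplicate _≟_ (replicate (suc j) k ++ xs))
      ≡⟨ cong (filter (¬? ∘ (k ≟_))) (deduplicate-block j k xs k∉xs) ⟩
    filter (¬? ∘ (k ≟_)) (k ∷ deduplicate _≟_ xs)
      ≡⟨ filter-reject (¬? ∘ (k ≟_)) (λ k≢k → k≢k refl) ⟩
    filter (¬? ∘ (k ≟_)) (deduplicate _≟_ xs)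
      ≡⟨ filter-all (¬? ∘ (k ≟_)) (All.deduplicate⁺ _≟_ k∉xs) ⟩
    deduplicate _≟_ xs ∎)
    where open ≡.≡-Reasoning

  multiplicity-block : ∀ j {k xs} → All (k ≢_) xs → multiplicity k (replicate j k ++ xs) ≡ j
  multiplicity-block zero    {k} k∉xs = cong length (filter-none (k ≟_) k∉xs)
  multiplicity-block (suc j) {k} k∉xs =
    trans (cong length (filter-accept (k ≟_) refl)) (cong suc (multiplicity-block j k∉xs))

  multiplicity-other : ∀ j {k y} xs → k ≢ y → multiplicity y (replicate j k ++ xs) ≡ multiplicity y xs
  multiplicity-other zero    xs k≢y = refl
  multiplicity-other (suc j) {k} {y} xs k≢y =
    trans (cong length (filter-reject (y ≟_) (k≢y ∘ sym))) (multiplicity-other j xs k≢y)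

  filter-odd-cong : ∀ {f g : ℕ → ℕ} {ys} → All (λ y → f y ≡ g y) ys →
    filter (λ y → f y % 2 ≟ 1) ys ≡ filter (λ y → g y % 2 ≟ 1) ys
  filter-odd-cong []                          = refl
  filter-odd-cong {g = g} {y ∷ ys} (eq ∷ eqs) rewrite eq with does (g y % 2 ≟ 1)
  ... | true  = cong (y ∷_) (filter-odd-cong eqs)
  ... | false = filter-odd-cong eqs

  unpaired-block : ∀ j k xs → All (k ≢_) xs →
    unpaired (replicate j k ++ xs) ≡ (if does (j % 2 ≟ 1) then k ∷ unpaired xs else unpaired xs)
  unpaired-block zero    k xs k∉xs = refl
  unpaired-block j@(suc j-1) k xs k∉xs = begin
    filter (odd block) (deduplicate _≟_ block)
      ≡⟨ cong (filter (odd block)) (deduplicate-block j-1 k xs k∉xs) ⟩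
    filter (odd block) (k ∷ deduplicate _≟_ xs)
      ≡⟨ filter-head ⟩
    (if does (j % 2 ≟ 1) then k ∷ filter (odd block) (deduplicate _≟_ xs)
                          else filter (odd block) (deduplicate _≟_ xs))
      ≡⟨ cong (λ ys → if does (j % 2 ≟ 1) then k ∷ ys else ys)
           (filter-odd-cong (All.map (multiplicity-other j xs) (All.deduplicate⁺ _≟_ k∉xs))) ⟩
    (if does (j % 2 ≟ 1) then k ∷ unpaired xs else unpaired xs) ∎
    where
    open ≡.≡-Reasoning
    block = replicate j k ++ xs
    odd = λ zs y → multiplicity y zs % 2 ≟ 1
    filter-head : ∀ {ys} → filter (odd block) (k ∷ ys) ≡
      (if does (j % 2 ≟ 1) then k ∷ filter (odd block) ys else filter (odd block) ys)
    filter-head with multiplicity k block | multiplicity-block j k∉xs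
    ... | _ | refl with does (j % 2 ≟ 1)
    ... | true  = refl
    ... | false = refl

  c₁-c₃ : List ℕ → ℤ
  c₁-c₃ parts = + c 1 parts ℤ.- + c 3 parts

  residue-count : ℕ → List ℕ → ℕ
  residue-count i = length ∘ filter (λ k → k % 4 ≟ i)

  residue-count-∷ : ∀ i k ys →
    + residue-count i (k ∷ ys) ≡ + (if does (k % 4 ≟ i) then 1 else 0) ℤ.+ + residue-count i ys
  residue-count-∷ i k ys with does (k % 4 ≟ i)
  ... | true  = refl
  ... | false = refl

  χ-residue : ∀ k → + (if does (k % 4 ≟ 1) then 1 else 0) ℤ.- + (if does (k % 4 ≟ 3) then 1 else 0) ≡ χ k
  χ-residue 0 = refl
  χ-residue 1 = refl
  χ-residue 2 = refl
  χ-residue 3 = refl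
  χ-residue (suc (suc (suc (suc k)))) = χ-residue k

  c₁-c₃-∷ : ∀ k ys →
    + residue-count 1 (k ∷ ys) ℤ.- + residue-count 3 (k ∷ ys) ≡
    χ k ℤ.+ (+ residue-count 1 ys ℤ.- + residue-count 3 ys)
  c₁-c₃-∷ k ys rewrite residue-count-∷ 1 k ys | residue-count-∷ 3 k ys | sym (χ-residue k) =
    lemma (+ (if does (k % 4 ≟ 1) then 1 else 0)) (+ residue-count 1 ys)
          (+ (if does (k % 4 ≟ 3) then 1 else 0)) (+ residue-count 3 ys)
    where
    lemma : ∀ a b c d → (a ℤ.+ b) ℤ.- (c ℤ.+ d) ≡ (a ℤ.- c) ℤ.+ (b ℤ.- d)
    lemma = solve-∀

  -- Only the parity of the multiplicity matters; summed over j against q^(jk), it produces the odd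
  -- series encoded by `isOdd`.
  c₁-c₃-block : ∀ j k xs → All (k ≢_) xs →
    c₁-c₃ (replicate j k ++ xs) ≡ isOdd j ℤ.* χ k ℤ.+ c₁-c₃ xs
  c₁-c₃-block j k xs k∉xs rewrite unpaired-block j k xs k∉xs = go j
    where
    go : ∀ j → (let ys = if does (j % 2 ≟ 1) then k ∷ unpaired xs else unpaired xs in
      + residue-count 1 ys ℤ.- + residue-count 3 ys) ≡ isOdd j ℤ.* χ k ℤ.+ c₁-c₃ xs
    go 0             = sym (ℤ.+-identityˡ _)
    go 1             = trans (c₁-c₃-∷ k (unpaired xs)) (cong (ℤ._+ c₁-c₃ xs) (sym (ℤ.*-identityˡ (χ k))))
    go (suc (suc j)) = go j

-- Recurrences for the count and the excess in the largest allowed part.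

module PartitionSums where
  open Blocks
  open ≡ using (refl; sym; trans; cong; cong₂)

  total : {A : Set} → (A → ℤ) → List A → ℤ
  total f xs = foldr ℤ._+_ (+ 0) (map f xs)

  total-++ : ∀ {A} (f : A → ℤ) xs ys → total f (xs ++ ys) ≡ total f xs ℤ.+ total f ys
  total-++ f []       ys = sym (ℤ.+-identityˡ _)
  total-++ f (x ∷ xs) ys = trans (cong (λ z → f x ℤ.+ z) (total-++ f xs ys)) (sym (ℤ.+-assoc (f x) (total f xs) (total f ys)))

  total-map : ∀ {A B} (f : B → ℤ) (g : A → B) xs → total f (map g xs) ≡ total (f ∘ g) xs
  total-map f g []       = refl
  total-map f g (x ∷ xs) = cong (λ z → f (g x) ℤ.+ z) (total-map f g xs)

  total-affine : ∀ {A} {f g : A → ℤ} a {xs} → All (λ x → f x ≡ a ℤ.+ g x) xs →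
                 total f xs ≡ a ℤ.* total (λ _ → + 1) xs ℤ.+ total g xs
  total-affine a []                                   = sym (trans (ℤ.+-identityʳ _) (ℤ.*-zeroʳ a))
  total-affine {g = g} a {x ∷ xs} (eq ∷ eqs) rewrite eq | total-affine a eqs = lemma a (g x) _ _
    where
    lemma : ∀ a y s t → (a ℤ.+ y) ℤ.+ (a ℤ.* s ℤ.+ t) ≡ a ℤ.* (+ 1 ℤ.+ s) ℤ.+ (y ℤ.+ t)
    lemma = solve-∀

  sumTo : ℕ → (ℕ → ℤ) → ℤ
  sumTo zero    g = + 0
  sumTo (suc n) g = g 0 ℤ.+ sumTo n (g ∘ suc)

  sumTo-cong : ∀ n f g → (∀ i → f i ≡ g i) → sumTo n f ≡ sumTo n g
  sumTo-cong zero    f g p = refl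
  sumTo-cong (suc n) f g p = cong₂ ℤ._+_ (p 0) (sumTo-cong n (f ∘ suc) (g ∘ suc) (p ∘ suc))

  sumTo-+ : ∀ n f g → sumTo n (λ i → f i ℤ.+ g i) ≡ sumTo n f ℤ.+ sumTo n g
  sumTo-+ zero    f g = refl
  sumTo-+ (suc n) f g = trans (cong (λ z → f 0 ℤ.+ g 0 ℤ.+ z) (sumTo-+ n (f ∘ suc) (g ∘ suc)))
    (lemma (f 0) (g 0) _ _)
    where
    lemma : ∀ a b c d → a ℤ.+ b ℤ.+ (c ℤ.+ d) ≡ (a ℤ.+ c) ℤ.+ (b ℤ.+ d)
    lemma = solve-∀

  total-concatMap : ∀ {A} (f : A → ℤ) (g : ℕ → List A) n (e : ℕ → ℕ) →
                    total f (concatMap g (applyUpTo e n)) ≡ sumTo n (λ j → total f (g (e j)))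
  total-concatMap f g zero    e = refl
  total-concatMap f g (suc n) e = trans (total-++ f (g (e 0)) _)
    (cong (λ z → total f (g (e 0)) ℤ.+ z) (total-concatMap f g n (e ∘ suc)))

  -- The coefficient of q^N in Σ q^(j(m+1)) F_j(q), where F_j has the coefficients `F j`.
  blockSum : ℕ → ℕ → (ℕ → ℕ → ℤ) → ℤ
  blockSum m N F = sumTo (suc (N / suc m)) (λ j → F j (N ℕ.∸ j ℕ.* suc m))

  blockSum-cong : ∀ m N F H → (∀ j N → F j N ≡ H j N) → blockSum m N F ≡ blockSum m N H
  blockSum-cong m N F H p = sumTo-cong (suc (N / suc m)) _ _ (λ j → p j (N ℕ.∸ j ℕ.* suc m))

  blockSum-+ : ∀ m N F H → blockSum m N (λ j N → F j N ℤ.+ H j N) ≡ blockSum m N F ℤ.+ blockSum m N H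
  blockSum-+ m N F H = sumTo-+ (suc (N / suc m))
    (λ j → F j (N ℕ.∸ j ℕ.* suc m)) (λ j → H j (N ℕ.∸ j ℕ.* suc m))

  total-partitions≤ : ∀ h m N → total h (partitions≤ (suc m) N) ≡
    blockSum m N (λ j N′ → total (h ∘ (replicate j (suc m) ++_)) (partitions≤ m N′))
  total-partitions≤ h m N = trans (total-concatMap h blocks (suc (N / suc m)) id)
    (blockSum-cong m N (λ j N′ → total h (map (replicate j (suc m) ++_) (partitions≤ m N′))) _
      (λ j N′ → total-map h (replicate j (suc m) ++_) (partitions≤ m N′)))
    where blocks = λ j → map (replicate j (suc m) ++_) (partitions≤ m (N ℕ.∸ j ℕ.* suc m))

  partitions≤-bound : ∀ m N → All (All (_≤ m)) (partitions≤ m N)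
  partitions≤-bound zero    zero    = [] ∷ []
  partitions≤-bound zero    (suc _) = []
  partitions≤-bound (suc m) N       = All.concat⁺ (All.map⁺ (All.universal (λ j → All.map⁺
    (All.map (λ xs≤m → All.++⁺ (All.replicate⁺ j ℕ.≤-refl) (All.map ℕ.m≤n⇒m≤1+n xs≤m))
      (partitions≤-bound m (N ℕ.∸ j ℕ.* suc m)))) (upTo (suc (N / suc m)))))

  count : ℕ → ℕ → ℤ
  count m N = total (λ _ → + 1) (partitions≤ m N)

  excess : ℕ → ℕ → ℤ
  excess m N = total c₁-c₃ (partitions≤ m N)

  -- The factor `+ 1` gives the summand the shape `v j * f N′` that `horner-coefficient` expects.
  count-suc : ∀ m N → count (suc m) N ≡ blockSum m N (λ j N′ → + 1 ℤ.* count m N′)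
  count-suc m N = trans (total-partitions≤ (λ _ → + 1) m N)
    (blockSum-cong m N (λ j → count m) _ (λ j N′ → sym (ℤ.*-identityˡ (count m N′))))

  -- The first sum is the contribution of the part m + 1 itself, once for each partition of the
  -- remainder; the second comes from the smaller parts.
  excess-suc : ∀ m N → excess (suc m) N ≡
    blockSum m N (λ j N′ → isOdd j ℤ.* (χ (suc m) ℤ.* count m N′)) ℤ.+
    blockSum m N (λ j N′ → + 1 ℤ.* excess m N′)
  excess-suc m N = trans (total-partitions≤ c₁-c₃ m N)
    (trans (blockSum-cong m N _ (λ j N′ → isOdd j ℤ.* (χ (suc m) ℤ.* count m N′) ℤ.+ + 1 ℤ.* excess m N′) block)
           (blockSum-+ m N (λ j N′ → isOdd j ℤ.* (χ (suc m) ℤ.* count m N′)) (λ j N′ → + 1 ℤ.* excess m N′)))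
    where
    block : ∀ j N′ → total (c₁-c₃ ∘ (replicate j (suc m) ++_)) (partitions≤ m N′) ≡
            isOdd j ℤ.* (χ (suc m) ℤ.* count m N′) ℤ.+ + 1 ℤ.* excess m N′
    block j N′ = trans
      (total-affine (isOdd j ℤ.* χ (suc m)) (All.map (λ {xs} xs≤m → c₁-c₃-block j (suc m) xs
        (All.map (λ x≤m → ℕ.<⇒≢ (s≤s x≤m) ∘ sym) xs≤m)) (partitions≤-bound m N′)))
      (cong₂ ℤ._+_ (ℤ.*-assoc (isOdd j) (χ (suc m)) (count m N′)) (sym (ℤ.*-identityˡ (excess m N′))))

-- The variable q and the residues of exponents.

module Monomial (A : CommutativeRing 0ℓ 0ℓ) (K : ℕ) where
  private module A = CommutativeRing A
  open A using (0#; 1#; _*_) renaming (_≈_ to _≈ᴬ_)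
  open PowerSeries A K
  open CommutativeRing truncated using (semiring)
  open import Algebra.Properties.Semiring.Exp semiring using (_^_)

  q : Series
  q zero    = 0#
  q (suc i) = const 1# i

  q-⊛-zero : ∀ f → (q ⊛ f) 0 ≈ᴬ 0#
  q-⊛-zero f = A.zeroˡ _

  q-⊛-suc : ∀ f i → (q ⊛ f) (suc i) ≈ᴬ f i
  q-⊛-suc f i = A.trans (A.+-cong (A.zeroˡ _) (⊛-identityˡ f i)) (A.+-identityˡ _)

  q^-⊛-below : ∀ n f {i} → i < n → ((q ^ n) ⊛ f) i ≈ᴬ 0#
  q^-⊛-below (suc n) f {zero}  _         = A.trans (⊛-assoc q (q ^ n) f 0) (q-⊛-zero ((q ^ n) ⊛ f))
  q^-⊛-below (suc n) f {suc i} (s≤s i<n) =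
    A.trans (⊛-assoc q (q ^ n) f (suc i)) (A.trans (q-⊛-suc ((q ^ n) ⊛ f) i) (q^-⊛-below n f i<n))

  q^-⊛-shift : ∀ n f i → ((q ^ n) ⊛ f) (n ℕ.+ i) ≈ᴬ f i
  q^-⊛-shift zero    f i = ⊛-identityˡ f i
  q^-⊛-shift (suc n) f i =
    A.trans (⊛-assoc q (q ^ n) f (suc (n ℕ.+ i))) (A.trans (q-⊛-suc ((q ^ n) ⊛ f) (n ℕ.+ i)) (q^-⊛-shift n f i))

  q^-off-diagonal : ∀ n {i} → i ≢ n → (q ^ n) i ≈ᴬ 0#
  q^-off-diagonal zero    {zero}  i≢n = contradiction ≡.refl i≢n
  q^-off-diagonal zero    {suc i} i≢n = A.refl
  q^-off-diagonal (suc n) {zero}  i≢n = q-⊛-zero (q ^ n)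
  q^-off-diagonal (suc n) {suc i} i≢n =
    A.trans (q-⊛-suc (q ^ n) i) (q^-off-diagonal n (i≢n ∘ ≡.cong suc))

  q-nilpotent : (q ^ K) ≈ᵏ const 0#
  q-nilpotent = mk≈ λ i i<K → A.trans (q^-off-diagonal K (ℕ.<⇒≢ i<K)) (const-0 i)
    where
    const-0 : ∀ i → 0# ≈ᴬ const 0# i
    const-0 zero    = A.refl
    const-0 (suc _) = A.refl

module Residues (A : CommutativeRing 0ℓ 0ℓ) (K p : ℕ) .{{_ : ℕ.NonZero p}} where
  private module A = CommutativeRing A
  open A using (0#; 1#; _*_) renaming (_≈_ to _≈ᴬ_)
  open PowerSeries A K
  open CommutativeRing truncated using (semiring)
  open import Algebra.Properties.Semiring.Exp semiring using (_^_)
  open Monomial A K using (q; q^-off-diagonal)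

  Bounded : ℕ → Series → Set
  Bounded r f = ∀ i → i < K → r < i % p → f i ≈ᴬ 0#

  bounded-resp : ∀ {r f g} → f ≈ᵏ g → Bounded r f → Bounded r g
  bounded-resp (mk≈ f≈g) b i i<K r<i = A.trans (A.sym (f≈g i i<K)) (b i i<K r<i)

  bounded-0 : ∀ {r f} → f ≈ᵏ const 0# → Bounded r f
  bounded-0 (mk≈ f≈0) zero    i<K _ = f≈0 0 i<K
  bounded-0 (mk≈ f≈0) (suc i) i<K _ = f≈0 (suc i) i<K

  bounded-+ : ∀ {r f g} → Bounded r f → Bounded r g → Bounded r (f ⊕ g)
  bounded-+ b c i i<K r<i = A.trans (A.+-cong (b i i<K r<i) (c i i<K r<i)) (A.+-identityˡ _)

  bounded-const : ∀ a → Bounded 0 (const a)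
  bounded-const a zero    _ 0<0 = contradiction (ℕ.<-≤-trans 0<0 (ℕ.m%n≤m 0 p)) λ ()
  bounded-const a (suc i) _ _   = A.refl

  bounded-q^ : ∀ {r} n → n % p ≤ r → Bounded r (q ^ n)
  bounded-q^ n n≤r i _ r<i = q^-off-diagonal n λ i≡n →
    contradiction (subst (λ z → _ < z % p) i≡n r<i) (ℕ.≤⇒≯ n≤r)

  ⊛-vanishes : ∀ f g n → (∀ i j → i ℕ.+ j ≡ n → f i * g j ≈ᴬ 0#) → (f ⊛ g) n ≈ᴬ 0#
  ⊛-vanishes f g zero    v = v 0 0 ≡.refl
  ⊛-vanishes f g (suc n) v = A.trans
    (A.+-cong (v 0 (suc n) ≡.refl) (⊛-vanishes (tail f) g n (λ i j eq → v (suc i) j (≡.cong suc eq))))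
    (A.+-identityˡ _)

  -- A pair of exponents that contributes satisfies (i + j) % p ≤ i % p + j % p ≤ r + s; wrapping
  -- around p only lowers the residue.
  bounded-* : ∀ {r s f g} → Bounded r f → Bounded s g → Bounded (r ℕ.+ s) (f ⊛ g)
  bounded-* {r} {s} {f} {g} b c n n<K r+s<n = ⊛-vanishes f g n term
    where
    term : ∀ i j → i ℕ.+ j ≡ n → f i * g j ≈ᴬ 0#
    term i j ≡.refl with i % p ℕ.≤? r | j % p ℕ.≤? s
    ... | no i≰r | _ =
      A.trans (A.*-congʳ (b i (ℕ.≤-<-trans (ℕ.m≤m+n i j) n<K) (ℕ.≰⇒> i≰r))) (A.zeroˡ _)
    ... | yes _ | no j≰s =
      A.trans (A.*-congˡ (c j (ℕ.≤-<-trans (ℕ.m≤n+m j i) n<K) (ℕ.≰⇒> j≰s))) (A.zeroʳ _)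
    ... | yes i≤r | yes j≤s = contradiction r+s<n (ℕ.≤⇒≯ (begin
      (i ℕ.+ j) % p           ≡⟨ ℕ.%-distribˡ-+ i j p ⟩
      (i % p ℕ.+ j % p) % p   ≤⟨ ℕ.m%n≤m (i % p ℕ.+ j % p) p ⟩
      i % p ℕ.+ j % p         ≤⟨ ℕ.+-mono-≤ i≤r j≤s ⟩
      r ℕ.+ s                 ∎))
      where open ℕ.≤-Reasoning

-- Bounded r f abstracts the condition that f involves only those powers of q whose exponent
-- has residue 0, …, r modulo 5.
record ResidueFiltration {R : CommutativeRing 0ℓ 0ℓ} (scalars : IntegerScalars R)
  (q : CommutativeRing.Carrier R) : Set₁ where
  open CommutativeRing R
  open Products scalars using (ι; _^_)
  field
    Bounded      : ℕ → Carrier → Set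
    bounded-resp : ∀ {r f g} → f ≈ g → Bounded r f → Bounded r g
    bounded-0    : ∀ r → Bounded r 0#
    bounded-+    : ∀ {r f g} → Bounded r f → Bounded r g → Bounded r (f + g)
    bounded-*    : ∀ {r s f g} → Bounded r f → Bounded s g → Bounded (r ℕ.+ s) (f * g)
    bounded-ι    : ∀ a → Bounded 0 (ι a)
    bounded-q^   : ∀ {r} n → n % 5 ≤ r → Bounded r (q ^ n)

-- The number x k + s k (k - 1) / 2, in a recursive form that follows `theta` and avoids the
-- division.
thetaExponent : ℕ → ℕ → ℕ → ℕ
thetaExponent x s zero    = 0
thetaExponent x s (suc k) = thetaExponent x s k ℕ.+ (x ℕ.+ s ℕ.* k)

Good : ℕ → ℕ → ℕ → ℤ → ℕ → Set
Good r x s d k = thetaExponent x s k % 5 ≤ r ⊎ + 5 Signed.∣ + 1 ℤ.+ d ℤ.* + k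

good? : ∀ r x s d k → Dec (Good r x s d k)
good? r x s d k = (thetaExponent x s k % 5 ℕ.≤? r) ⊎-dec (+ 5 Signed.∣? (+ 1 ℤ.+ d ℤ.* + k))

-- Five steps raise the exponent by 5 x + 5 s k + 10 s, where 10 = 0 + 1 + 2 + 3 + 4, and the
-- coefficient by 5 d.
good-periodic : ∀ r x s d k → Good r x s d k → Good r x s d (5 ℕ.+ k)
good-periodic r x s d k = Sum.map
  (subst (_≤ r) (≡.sym (≡.trans (≡.cong (_% 5) (lemma₁ (thetaExponent x s k) x s k))
    (ℕ.[m+kn]%n≡m%n (thetaExponent x s k) (x ℕ.+ s ℕ.* (k ℕ.+ 2)) 5))))
  (λ 5∣ → subst (+ 5 Signed.∣_) (≡.sym (lemma₂ d (+ k)))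
    (Signed.∣m∣n⇒∣m+n 5∣ (Signed.∣n⇒∣m*n d (Signed.divides (+ 1) ≡.refl))))
  where
  lemma₁ : ∀ t x s k → t ℕ.+ (x ℕ.+ s ℕ.* k) ℕ.+ (x ℕ.+ s ℕ.* (1 ℕ.+ k)) ℕ.+ (x ℕ.+ s ℕ.* (2 ℕ.+ k))
    ℕ.+ (x ℕ.+ s ℕ.* (3 ℕ.+ k)) ℕ.+ (x ℕ.+ s ℕ.* (4 ℕ.+ k)) ≡ t ℕ.+ (x ℕ.+ s ℕ.* (k ℕ.+ 2)) ℕ.* 5
  lemma₁ = ℕ-Solver.solve-∀
  lemma₂ : ∀ d x → + 1 ℤ.+ d ℤ.* (+ 5 ℤ.+ x) ≡ + 1 ℤ.+ d ℤ.* x ℤ.+ d ℤ.* + 5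
  lemma₂ = solve-∀

-- Periodicity leaves k < 5, and for numerical parameters the implicit `True` argument settles these
-- five cases by evaluation.
good : ∀ r x s d {_ : True (ℕ.allUpTo? (good? r x s d) 5)} → ∀ k → Good r x s d k
good r x s d {t} = go
  where
  base : ∀ {k} → k < 5 → Good r x s d k
  base = toWitness t
  go : ∀ k → Good r x s d k
  go 0 = base (s≤s z≤n)
  go 1 = base (s≤s (s≤s z≤n))
  go 2 = base (s≤s (s≤s (s≤s z≤n)))
  go 3 = base (s≤s (s≤s (s≤s (s≤s z≤n))))
  go 4 = base (s≤s (s≤s (s≤s (s≤s (s≤s z≤n)))))
  go (suc (suc (suc (suc (suc k))))) = good-periodic r x s d k (go k)

-- Absence of exponents with residue 4.

module Dissection {R : CommutativeRing 0ℓ 0ℓ} (scalars : IntegerScalars R) (k : ℕ)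
  (q : CommutativeRing.Carrier R)
  (q-nilpotent : CommutativeRing._≈_ R (Products._^_ scalars q (suc k)) (CommutativeRing.0# R))
  (5≈0 : CommutativeRing._≈_ R (Products.ι scalars (+ 5)) (CommutativeRing.0# R))
  (filtration : ResidueFiltration scalars q) where
  open CommutativeRing R
  open Products scalars
  open Identities scalars k q q-nilpotent
  open CharacteristicFive 5≈0
  open ResidueFiltration filtration
  open import Relation.Binary.Reasoning.Setoid setoid

  ι-multiple : ∀ {a} → + 5 Signed.∣ a → ι a ≈ 0#
  ι-multiple (Signed.divides b ≡.refl) = trans (ι-* b (+ 5)) (trans (*-congˡ 5≈0) (zeroʳ _))

  bounded-^ : ∀ {f} n → Bounded 0 f → Bounded 0 (f ^ n)
  bounded-^ zero    b = bounded-ι (+ 1)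
  bounded-^ (suc n) b = bounded-* b (bounded-^ n b)

  bounded-horner : ∀ n v {x} → Bounded 0 x → Bounded 0 (horner n v x)
  bounded-horner zero    v b = bounded-0 0
  bounded-horner (suc n) v b =
    bounded-+ (bounded-ι (v 0)) (bounded-* b (bounded-horner n (λ j → v (suc j)) b))

  bounded-prod : ∀ n f → (∀ i → Bounded 0 (f i)) → Bounded 0 (prod n f)
  bounded-prod zero    f b = bounded-ι (+ 1)
  bounded-prod (suc n) f b = bounded-* (bounded-prod n f b) (b n)

  bounded-E⁻¹ : ∀ m → suc m % 5 ≡ 0 → Bounded 0 (E⁻¹ m)
  bounded-E⁻¹ m 5∣m = bounded-prod K (λ i → geo K ((q ^ suc m) ^ suc i)) (λ i →
    bounded-horner K (λ _ → + 1) (bounded-^ (suc i) (bounded-q^ (suc m) (ℕ.≤-reflexive 5∣m))))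

  -- At a negative index -k the coefficient is 1 - d k, hence `- d` in `goodʳ`.
  module Theta (m : ℕ) (x y : ℕ) (αβ≈Q : q ^ x * q ^ y ≈ q ^ suc m) (s : Carrier) (s²≈1 : s * s ≈ 1#)
    (bounded-s : Bounded 0 s) (d : ℤ) (r : ℕ)
    (goodˡ : ∀ k → Good r x (suc m) d k) (goodʳ : ∀ k → Good r y (suc m) (ℤ.- d) k) where
    open Triple m (q ^ x) (q ^ y)
    open Weighted αβ≈Q s s²≈1 d

    theta≈ : ∀ z n → theta (q ^ z) n ≈ q ^ thetaExponent z (suc m) n
    theta≈ z zero    = refl
    theta≈ z (suc n) = trans
      (*-cong (theta≈ z n) (trans (*-congˡ (^-assocʳ q (suc m) n)) (sym (^-homo-* q z (suc m ℕ.* n)))))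
      (sym (^-homo-* q (thetaExponent z (suc m) n) (z ℕ.+ suc m ℕ.* n)))

    bounded-theta : ∀ z n e {a} → Good r z (suc m) e n → + 1 ℤ.+ e ℤ.* + n ≡ a →
                    Bounded r (theta (q ^ z) n * ι a)
    bounded-theta z n e {a} (inj₁ t) _ =
      subst (λ j → Bounded j (theta (q ^ z) n * ι a)) (ℕ.+-identityʳ r)
        (bounded-* (bounded-resp (sym (theta≈ z n)) (bounded-q^ (thetaExponent z (suc m) n) t)) (bounded-ι a))
    bounded-theta z n e (inj₂ 5∣) ≡.refl =
      bounded-resp (sym (trans (*-congˡ (ι-multiple 5∣)) (zeroʳ _))) (bounded-0 r)

    bounded-T : ∀ i b → Bounded r (T i b * ι (slope i b))
    bounded-T zero    b       = bounded-theta y b (ℤ.- d) (goodʳ b) (lemma d (+ b))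
      where
      lemma : ∀ d b → + 1 ℤ.+ (ℤ.- d) ℤ.* b ≡ + 1 ℤ.+ d ℤ.* (+ 0 ℤ.- b)
      lemma = solve-∀
    bounded-T (suc i) zero    = bounded-theta x (suc i) d (goodˡ (suc i)) (lemma d (+ suc i))
      where
      lemma : ∀ d b → + 1 ℤ.+ d ℤ.* b ≡ + 1 ℤ.+ d ℤ.* (b ℤ.- + 0)
      lemma = solve-∀
    bounded-T (suc i) (suc b) = bounded-resp (*-congˡ (sym (slope-suc² i b))) (bounded-T i b)

    bounded-anti : ∀ n F → (∀ i j → Bounded r (F i j)) → Bounded r (anti n F)
    bounded-anti zero    F b = b 0 0
    bounded-anti (suc n) F b = bounded-+ (b 0 (suc n)) (bounded-anti n _ (λ i → b (suc i)))

    bounded-Θ : ∀ n b → Bounded r (anti n (λ i _ → T i b * w₁ i b))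
    bounded-Θ n b = bounded-anti n _ λ i _ → bounded-resp
      (solve 3 (λ s t c → s :* (t :* c) := t :* (s :* c)) refl (s ^ (i ℕ.+ b)) (T i b) (ι (slope i b)))
      (bounded-* (bounded-^ (i ℕ.+ b) bounded-s) (bounded-T i b))

  bounded-−1 : Bounded 0 (- 1#)
  bounded-−1 = bounded-resp (ι-neg (+ 1)) (bounded-ι (ℤ.- (+ 1)))

  -- A triangular number k (k + 1) / 2 has residue 0, 1 or 3, and 3 only for k ≡ 2 modulo 5, where 5
  -- divides 2k + 1.
  bounded-Θ₁ : Bounded 1 (Jacobi.Θ 0)
  bounded-Θ₁ = Theta.bounded-Θ 0 1 0 (*-identityʳ (q ^ 1)) (- 1#) -1*-1≈1 bounded-−1 (+ 2) 1
    (good 1 1 1 (+ 2)) (good 1 0 1 (ℤ.- + 2)) (M ℕ.+ M) M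

  bounded-Θ₂ : Bounded 2 (Jacobi.Θ 1)
  bounded-Θ₂ = Theta.bounded-Θ 1 2 0 (*-identityʳ (q ^ 2)) (- 1#) -1*-1≈1 bounded-−1 (+ 2) 2
    (good 2 2 2 (+ 2)) (good 2 0 2 (ℤ.- + 2)) (M ℕ.+ M) M

  -- The residue of 2k² + k exceeds 1 only for k ≡ 1 modulo 5, where 5 divides 4k + 1.
  bounded-Θ₄ : Bounded 1 TwoSquares.Θ
  bounded-Θ₄ = Theta.bounded-Θ 3 3 1 (sym (^-homo-* q 3 1)) 1# (*-identityˡ 1#) (bounded-ι (+ 1)) (+ 4) 1
    (good 1 3 4 (+ 4)) (good 1 1 4 (ℤ.- + 4)) (M ℕ.+ M) M

  bounded-E⁻¹S : Bounded 3 (E⁻¹ 0 * S)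
  bounded-E⁻¹S = bounded-resp (begin
    -- The combination 8 P - 4 · 2 P (1 - 4 S) = 32 P S eliminates P alone, and 3 inverts 32 modulo
    -- 5: 96 = 5 · 19 + 1.
    ι (+ 3) * (ι (+ 8) * P + ι (ℤ.- + 4) * (ι (+ 2) * (P * (1# - ι (+ 4) * S))))
      ≈⟨ solve 2 (λ p s → con (+ 3) :* (con (+ 8) :* p :+ con (ℤ.- + 4) :* (con (+ 2) :* (p :* (con (+ 1) :- con (+ 4) :* s))))
           := con (+ 5) :* (con (+ 19) :* (p :* s)) :+ p :* s) refl P S ⟩
    ι (+ 5) * (ι (+ 19) * (P * S)) + P * S
      ≈⟨ +-congʳ (trans (*-congʳ 5≈0) (zeroˡ _)) ⟩
    0# + P * S
      ≈⟨ +-identityˡ _ ⟩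
    P * S ∎)
    (bounded-* (bounded-ι (+ 3)) (bounded-+
      (bounded-resp (sym partitions-expansion)
        (bounded-* (bounded-* (bounded-* bounded-Θ₁ bounded-Θ₁) bounded-Θ₁)
                   (bounded-* (bounded-E⁻¹ 4 ≡.refl) (bounded-E⁻¹ 4 ≡.refl))))
      (bounded-* (bounded-ι (ℤ.- + 4)) (bounded-resp (sym lambert-expansion)
        (bounded-* (bounded-* bounded-Θ₄ bounded-Θ₂) (bounded-E⁻¹ 9 ≡.refl))))))
    where P = E⁻¹ 0

  -- `P m` and `A m` stand for the generating functions of count and excess over partitions with
  -- parts at most m, given only by their recurrences.
  module _ (P A : ℕ → Carrier) (P₀ : P 0 ≈ 1#) (A₀ : A 0 ≈ 0#)
    (P-suc : ∀ m → P (suc m) ≈ geo K (q ^ suc m) * P m)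
    (A-suc : ∀ m → A (suc m) ≈ horner K isOdd (q ^ suc m) * (ι (χ (suc m)) * P m) + geo K (q ^ suc m) * A m)
    where

    P-product : ∀ m → P m ≈ prod m (λ i → geo K (q ^ suc i))
    P-product zero    = P₀
    P-product (suc m) = trans (P-suc m) (trans (*-congˡ (P-product m)) (*-comm _ _))

    A-product : ∀ m → A m ≈ P m * sum m (λ i → L (suc i))
    A-product zero    = trans A₀ (sym (zeroʳ _))
    A-product (suc m) = begin
      A (suc m)
        ≈⟨ A-suc m ⟩
      o * (ι (χ (suc m)) * P m) + g * A m
        ≈⟨ +-congˡ (*-congˡ (A-product m)) ⟩
      o * (ι (χ (suc m)) * P m) + g * (P m * s)
        ≈⟨ solve 5 (λ o c p g s → o :* (c :* p) :+ g :* (p :* s) := con (+ 1) :* (o :* (c :* p)) :+ g :* (p :* s))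
             refl o (ι (χ (suc m))) (P m) g s ⟩
      1# * (o * (ι (χ (suc m)) * P m)) + g * (P m * s)
        -- Writing 1 as g (1 - x) completes `o` to the Lambert term o (1 - x) and supplies the `g`
        -- needed to factor out `P (suc m)`.
        ≈⟨ +-congʳ (*-congʳ (geo-inverse {K} (power-nilpotent m))) ⟨
      g * (1# - x) * (o * (ι (χ (suc m)) * P m)) + g * (P m * s)
        ≈⟨ solve 6 (λ o c p g s x → g :* (con (+ 1) :- x) :* (o :* (c :* p)) :+ g :* (p :* s)
             := g :* p :* (s :+ c :* (o :* (con (+ 1) :- x)))) refl o (ι (χ (suc m))) (P m) g s x ⟩
      g * P m * (s + L (suc m))
        ≈⟨ *-congʳ (P-suc m) ⟨
      P (suc m) * (s + L (suc m)) ∎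
      where
      x = q ^ suc m
      o = horner K isOdd x
      g = geo K x
      s = sum m (λ i → L (suc i))

    bounded-A : Bounded 3 (A K)
    bounded-A = bounded-resp (trans (*-congʳ (sym E⁻¹≈P)) (sym (A-product K))) bounded-E⁻¹S
      where
      horner-cong : ∀ n v {x y} → x ≈ y → horner n v x ≈ horner n v y
      horner-cong zero    v x≈y = refl
      horner-cong (suc n) v x≈y = +-congˡ (*-cong x≈y (horner-cong n (λ j → v (suc j)) x≈y))
      E⁻¹≈P : P K ≈ E⁻¹ 0
      E⁻¹≈P = trans (P-product K) (prod-cong K (λ i → horner-cong K (λ _ → + 1)
        (trans (reflexive (≡.cong (q ^_) (≡.sym (ℕ.*-identityˡ (suc i))))) (sym (^-assocʳ q 1 (suc i))))))

open import Data.Integer using (_-_)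

-- Specialisation to series over ℤ/5, with q^k as the last power retained.

module ModuloFive (k : ℕ) where
  open IntegersModulo (+ 5) using (_≋_; mk≋; ≋-reflexive) renaming (ring to ℤ/5)
  K : ℕ
  K = suc k
  open PowerSeries ℤ/5 K
  private module A = CommutativeRing ℤ/5

  scalars : IntegerScalars truncated
  scalars = record
    { ⟦_⟧ = const
    ; +-homo = λ a b → pointwise (const-+ a b)
    ; *-homo = λ a b → pointwise (const-* a b)
    ; -‿homo = λ a → pointwise (const-neg a)
    ; 0-homo = pointwise (λ _ → A.refl)
    ; 1-homo = pointwise (λ _ → A.refl)
    }

  private module R = CommutativeRing truncated

  ι : ℤ → Series
  ι = Products.ι {truncated} scalars
  open Monomial ℤ/5 K using (q; q-nilpotent; q^-⊛-below; q^-⊛-shift)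
  open Residues ℤ/5 K 5

  5≈0 : ι (+ 5) ≈ᵏ const (+ 0)
  5≈0 = pointwise λ
    { zero    → mk≋ (Signed.divides (+ 1) ≡.refl)
    ; (suc _) → A.refl }

  filtration : ResidueFiltration {truncated} scalars q
  filtration = record
    { Bounded      = Bounded
    ; bounded-resp = λ {r} {f} {g} → bounded-resp {r} {f} {g}
    ; bounded-0    = λ r → bounded-0 R.refl
    ; bounded-+    = λ {r} {f} {g} → bounded-+ {r} {f} {g}
    ; bounded-*    = λ {r} {s} {f} {g} → bounded-* {r} {s} {f} {g}
    ; bounded-ι    = λ a → bounded-resp {0} {const a} {ι a} (R.sym (Products.ι≈ {truncated} scalars a)) (bounded-const a)
    ; bounded-q^   = bounded-q^
    }

  private
    horner : ℕ → (ℕ → ℤ) → Series → Series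
    horner = Products.horner {truncated} scalars
    infixr 8 _^_
    _^_ : Series → ℕ → Series
    _^_ = Products._^_ {truncated} scalars

  open PartitionSums

  -- Multiplying by Σⱼ vⱼ x^j with x = q^(m+1) is summation over the multiplicity j of the part m+1.
  horner-coefficient : ∀ n v m f N → N < K → N / suc m < n →
    (horner n v (q ^ suc m) ⊛ f) N ≋ blockSum m N (λ j N′ → v j ℤ.* f N′)
  horner-coefficient (suc n) v m f N N<K N/m<n = begin
    ((ι (v 0) ⊕ x ⊛ h) ⊛ f) N
      ≈⟨ ⊛-distribʳ f (ι (v 0)) (x ⊛ h) N ⟩
    (ι (v 0) ⊛ f) N ℤ.+ ((x ⊛ h) ⊛ f) N
      ≈⟨ A.+-cong (_≈ᵏ_.coeff (R.*-congʳ {f} (Products.ι≈ {truncated} scalars (v 0))) N N<K) (⊛-assoc x h f N) ⟩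
    (const (v 0) ⊛ f) N ℤ.+ (x ⊛ (h ⊛ f)) N
      ≈⟨ A.+-cong (const-⊛ (v 0) f N) rest ⟩
    v 0 ℤ.* f N ℤ.+ sumTo (N / suc m) (λ j → v (suc j) ℤ.* f (N ℕ.∸ suc j ℕ.* suc m)) ∎
    where
    open import Relation.Binary.Reasoning.Setoid A.setoid
    x = q ^ suc m
    h = horner n (v ∘ suc) x
    rest : (x ⊛ (h ⊛ f)) N ≋ sumTo (N / suc m) (λ j → v (suc j) ℤ.* f (N ℕ.∸ suc j ℕ.* suc m))
    rest with suc m ℕ.≤? N
    ... | no m≰N = A.trans (q^-⊛-below (suc m) (h ⊛ f) (ℕ.≰⇒> m≰N)) (≋-reflexive
      (≡.cong (λ t → sumTo t (λ j → v (suc j) ℤ.* f (N ℕ.∸ suc j ℕ.* suc m)))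
        (≡.sym (ℕ.m<n⇒m/n≡0 (ℕ.≰⇒> m≰N)))))
    -- Multiplicity `suc j` for N corresponds to multiplicity `j` for N - (m + 1), and the quotient
    -- by m + 1 drops by one, so the sums agree term by term.
    ... | yes m≤N with N′ , ≡.refl ← ℕ.m≤n⇒∃[o]m+o≡n m≤N = begin
      (x ⊛ (h ⊛ f)) (suc m ℕ.+ N′)
        ≈⟨ q^-⊛-shift (suc m) (h ⊛ f) N′ ⟩
      (h ⊛ f) N′
        ≈⟨ horner-coefficient n (v ∘ suc) m f N′ (ℕ.≤-<-trans (ℕ.m≤n+m N′ (suc m)) N<K)
             (ℕ.≤-pred (subst (_< suc n) quotient N/m<n)) ⟩
      blockSum m N′ (λ j N″ → v (suc j) ℤ.* f N″)
        ≡⟨ sumTo-cong (suc (N′ / suc m)) _ _ (λ j → ≡.cong (λ t → v (suc j) ℤ.* f t)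
             (≡.sym (ℕ.[m+n]∸[m+o]≡n∸o (suc m) N′ (j ℕ.* suc m)))) ⟩
      sumTo (suc (N′ / suc m)) (λ j → v (suc j) ℤ.* f (suc m ℕ.+ N′ ℕ.∸ suc j ℕ.* suc m))
        ≡⟨ ≡.cong (λ t → sumTo t (λ j → v (suc j) ℤ.* f (suc m ℕ.+ N′ ℕ.∸ suc j ℕ.* suc m))) quotient ⟨
      sumTo ((suc m ℕ.+ N′) / suc m) (λ j → v (suc j) ℤ.* f (suc m ℕ.+ N′ ℕ.∸ suc j ℕ.* suc m)) ∎
      where
      quotient : (suc m ℕ.+ N′) / suc m ≡ suc (N′ / suc m)
      quotient = ≡.trans (ℕ.m/n≡1+[m∸n]/n m≤N) (≡.cong (λ t → suc (t / suc m)) (ℕ.m+n∸m≡n (suc m) N′))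

  quotient<K : ∀ {m N} → N < K → N / suc m < K
  quotient<K {m} {N} N<K = ℕ.≤-<-trans (ℕ.m/n≤m N (suc m)) N<K

  count-series : ∀ m → count (suc m) ≈ᵏ (horner K (λ _ → + 1) (q ^ suc m) ⊛ count m)
  count-series m = mk≈ λ N N<K → A.trans (≋-reflexive (count-suc m N))
    (A.sym (horner-coefficient K (λ _ → + 1) m (count m) N N<K (quotient<K N<K)))

  excess-series : ∀ m → excess (suc m) ≈ᵏ
    ((horner K isOdd (q ^ suc m) ⊛ (ι (χ (suc m)) ⊛ count m)) ⊕ (horner K (λ _ → + 1) (q ^ suc m) ⊛ excess m))
  excess-series m = R.trans (mk≈ λ N N<K → A.trans (≋-reflexive (excess-suc m N)) (A.sym (A.+-cong
      (horner-coefficient K isOdd m (λ N → χ (suc m) ℤ.* count m N) N N<K (quotient<K N<K))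
      (horner-coefficient K (λ _ → + 1) m (excess m) N N<K (quotient<K N<K)))))
    (R.+-congʳ (R.*-congˡ {horner K isOdd (q ^ suc m)} (R.trans
      (pointwise (λ N → A.sym (const-⊛ (χ (suc m)) (count m) N)))
      (R.*-congʳ {count m} (R.sym (Products.ι≈ {truncated} scalars (χ (suc m))))))))

  count-0 : count 0 ≈ᵏ const (+ 1)
  count-0 = pointwise λ { zero → A.refl ; (suc _) → A.refl }

  excess-0 : excess 0 ≈ᵏ const (+ 0)
  excess-0 = pointwise λ { zero → A.refl ; (suc _) → A.refl }

  excess-bounded : Bounded 3 (excess K)
  excess-bounded = Dissection.bounded-A {truncated} scalars k q q-nilpotent 5≈0 filtration count excess
    count-0 excess-0 count-series excess-series

  -- A partition of k has no part K = k + 1, so only j = 0 remains. This links the truncation order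
  -- K to `partitions k`, whose parts are bounded by k.
  excess-stable : excess K k ≡ excess k k
  excess-stable = begin
    excess K k
      ≡⟨ excess-suc k k ⟩
    blockSum k k F ℤ.+ blockSum k k H
      ≡⟨ ≡.cong₂ (λ s t → sumTo (suc s) F′ ℤ.+ sumTo (suc t) H′) k/K≡0 k/K≡0 ⟩
    + 0 ℤ.+ (+ 1 ℤ.* excess k k ℤ.+ + 0)
      ≡⟨ lemma (excess k k) ⟩
    excess k k ∎
    where
    open ≡.≡-Reasoning
    F H : ℕ → ℕ → ℤ
    F j N = isOdd j ℤ.* (χ K ℤ.* count k N)
    H j N = + 1 ℤ.* excess k N
    F′ H′ : ℕ → ℤ
    F′ j = F j (k ℕ.∸ j ℕ.* K)
    H′ j = H j (k ℕ.∸ j ℕ.* K)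
    k/K≡0 : k / K ≡ 0
    k/K≡0 = ℕ.m<n⇒m/n≡0 (ℕ.n<1+n k)
    lemma : ∀ a → + 0 ℤ.+ (+ 1 ℤ.* a ℤ.+ + 0) ≡ a
    lemma = solve-∀

  excess-divisible : 3 < k % 5 → + 5 ∣ ∑[ k ⊢] (λ parts → + c 1 parts - + c 3 parts)
  excess-divisible 3<k = Signed.∣⇒∣ᵤ (subst (+ 5 Signed.∣_)
    (≡.trans (ℤ.+-identityʳ (excess K k)) excess-stable)
    (_≋_.divides-difference (excess-bounded k ℕ.≤-refl 3<k)))

theorem2p8 : ∀ (n : ℕ) →
    + 5 ∣ ∑[ 5 ℕ.* n ℕ.+ 4 ⊢] (λ parts → + c 1 parts - + c 3 parts)
theorem2p8 n = ModuloFive.excess-divisible (5 ℕ.* n ℕ.+ 4) (ℕ.≤-reflexive (≡.sym residue))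
  where
  residue : (5 ℕ.* n ℕ.+ 4) % 5 ≡ 4
  residue = ≡.trans (≡.cong (_% 5) (lemma n)) (ℕ.[m+kn]%n≡m%n 4 n 5)
    where
    lemma : ∀ n → 5 ℕ.* n ℕ.+ 4 ≡ 4 ℕ.+ n ℕ.* 5
    lemma = ℕ-Solver.solve-∀
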